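{- Let $F$ be a simple graph of order $n\ge 1$, let $V_k=\{v_1,\ldots,v_k\}$ be a subset of the vertex set of $F$, and let $H_v$ be a simple graph of order $m\ge 2$ with a specified vertex $v$ of degree $m-1$. Let $H_1=H_v-v$ be an $r_1$-regular graph, where $r_1\ge 1$. Let $\lambda\in\sigma(A(H_v))\setminus\{\alpha,\beta\}$, where $\alpha,\beta$ are the roots of the equation $x^2-r_1x-m+1=0$, and let $G=G[F,V_k,H_v]$. If $|V_k|=k$, then $\lambda\in\sigma(A(G))$ with multiplicity $k$. Moreover, the remaining $n+k$ $A$-eigenvalues of $G$ are independent of $H_v$.
   Context: All graphs are finite and simple. $A(X)$ denotes the adjacency matrix of a graph $X$; the $A$-eigenvalues of $X$ are the eigenvalues of $A(X)$, and $\sigma(A(X))$ is the spectrum of $A(X)$, consisting of all its eigenvalues. Under the stated hypotheses, $\sigma(A(H_v))=(\sigma(A(H_1))-\{r_1\})\cup\{\alpha,\beta\}$. Graph with $k$ pockets: $G[F,V_k,H_v]$ is the graph obtained by taking one copy of $F$ and $k$ vertex-disjoint copies of $H_v$, and then, for each $i=1,\ldots,k$, identifying the vertex $v$ of the $i$th copy of $H_v$ with the vertex $v_i$ of $F$. -}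

module Defs where

open import Level using (Level; _⊔_) renaming (suc to lsuc)
open import Algebra.Apartness.Bundles using (HeytingField)
open import Algebra.Bundles using (CommutativeRing)
open import Data.Bool.Base using (Bool; true; false; _∧_; if_then_else_)
open import Data.Bool.Properties using (∧-zeroʳ)
open import Data.Fin.Base using (Fin; zero; suc; toℕ; punchIn; splitAt; remQuot)
open import Data.Fin.Properties using (_≟_)
open import Data.Fin.Subset using (Subset; ∣_∣)
open import Data.List.Base using (List; foldr; length)
open import Data.Nat.Base using (ℕ; zero; suc; pred) renaming (_+_ to _ℕ+_; _*_ to _ℕ*_)
open import Data.Product.Base using (_×_; _,_; ∃)
open import Data.Sum.Base using (_⊎_; inj₁; inj₂; map₂)
open import Data.Vec.Base using (tabulate)
open import Relation.Binary.Definitions using (Decidable)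
open import Relation.Binary.PropositionalEquality.Core using (_≡_; refl; cong₂)
open import Relation.Nullary.Decidable.Core using (⌊_⌋; yes; no)
open import Relation.Nullary.Negation.Core using (contradiction)
import Relation.Binary.PropositionalEquality.Core as ≡
import Algebra.Properties.Monoid.Mult as Mult
import Algebra.Properties.Monoid.Sum as Sum
import Algebra.Properties.Semiring.Exp as Exp

record Graph (n : ℕ) : Set where
  field
    adj     : Fin n → Fin n → Bool
    adj-sym : ∀ u w → adj u w ≡ adj w u
    adj-irr : ∀ u → adj u u ≡ false

open Graph public

degree : ∀ {n} → Graph n → Fin n → ℕ
degree X u = ∣ tabulate (adj X u) ∣

Regular : ∀ {n} → ℕ → Graph n → Set
Regular r X = ∀ u → degree X u ≡ r

-- Enumerates the vertices different from v in increasing order.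
others : ∀ {m} → Fin m → Fin (pred m) → Fin m
others {suc m} v = punchIn v

delete : ∀ {m} → Graph m → Fin m → Graph (pred m)
delete H v = record
  { adj     = λ x y → adj H (others v x) (others v y)
  ; adj-sym = λ x y → adj-sym H (others v x) (others v y)
  ; adj-irr = λ x → adj-irr H (others v x)
  }

-- A vertex of F[v₁,…,v_k; H] is either a vertex of F or a pair (i , x), which
-- is the vertex  others v x  of the i-th copy of H; the vertex v of that copy
-- is identified with  p i = v_i  and hence is not listed again.
module _ {n k m : ℕ} (F : Graph n) (p : Fin k → Fin n) (H : Graph m) (v : Fin m) where

  PocketVertex : Set
  PocketVertex = Fin n ⊎ (Fin k × Fin (pred m))

  pocketAdj : PocketVertex → PocketVertex → Bool
  pocketAdj (inj₁ u)       (inj₁ w)       = adj F u w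
  pocketAdj (inj₁ u)       (inj₂ (i , x)) = ⌊ u ≟ p i ⌋ ∧ adj H v (others v x)
  pocketAdj (inj₂ (i , x)) (inj₁ u)       = ⌊ u ≟ p i ⌋ ∧ adj H v (others v x)
  pocketAdj (inj₂ (i , x)) (inj₂ (j , y)) = ⌊ i ≟ j ⌋ ∧ adj H (others v x) (others v y)

  pocketAdj-sym : ∀ a b → pocketAdj a b ≡ pocketAdj b a
  pocketAdj-sym (inj₁ u)       (inj₁ w)       = adj-sym F u w
  pocketAdj-sym (inj₁ u)       (inj₂ (i , x)) = refl
  pocketAdj-sym (inj₂ (i , x)) (inj₁ u)       = refl
  pocketAdj-sym (inj₂ (i , x)) (inj₂ (j , y)) =
    cong₂ _∧_ (≟-sym i j) (adj-sym H (others v x) (others v y))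
    where
    ≟-sym : ∀ (i j : Fin k) → ⌊ i ≟ j ⌋ ≡ ⌊ j ≟ i ⌋
    ≟-sym i j with i ≟ j | j ≟ i
    ... | yes _   | yes _   = refl
    ... | no  _   | no  _   = refl
    ... | yes i≡j | no  j≢i = contradiction (≡.sym i≡j) j≢i
    ... | no  i≢j | yes j≡i = contradiction (≡.sym j≡i) i≢j

  pocketAdj-irr : ∀ a → pocketAdj a a ≡ false
  pocketAdj-irr (inj₁ u)       = adj-irr F u
  pocketAdj-irr (inj₂ (i , x)) =
    ≡.trans (≡.cong (⌊ i ≟ i ⌋ ∧_) (adj-irr H (others v x))) (∧-zeroʳ ⌊ i ≟ i ⌋)

  vertex : Fin (n ℕ+ k ℕ* pred m) → PocketVertex
  vertex a = map₂ (remQuot (pred m)) (splitAt n a)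

  pockets : Graph (n ℕ+ k ℕ* pred m)
  pockets = record
    { adj     = λ a b → pocketAdj (vertex a) (vertex b)
    ; adj-sym = λ a b → pocketAdj-sym (vertex a) (vertex b)
    ; adj-irr = λ a → pocketAdj-irr (vertex a)
    }

module Spectrum {c ℓ : Level} (R : CommutativeRing c ℓ) where

  open CommutativeRing R hiding (refl; sym; trans; zero)
  open Sum +-monoid public using (sum)
  open Mult +-monoid public using () renaming (_×_ to _·_)
  open Exp semiring public using (_^_)

  Matrix : ℕ → Set c
  Matrix n = Fin n → Fin n → Carrier

  Symmetric : ∀ {n} → Matrix n → Set ℓ
  Symmetric M = ∀ i j → M i j ≈ M j i

  det : ∀ {n} → Matrix n → Carrier
  det {zero}  M = 1#
  det {suc n} M =
    sum λ j → (- 1#) ^ toℕ j * (M zero j * det (λ a b → M (suc a) (punchIn j b)))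

  scalar : ∀ {n} → Carrier → Matrix n
  scalar x i j = if ⌊ i ≟ j ⌋ then x else 0#

  charPoly : ∀ {n} → Matrix n → Carrier → Carrier
  charPoly M x = det (λ i j → scalar x i j - M i j)

  -- σ lists the roots, with multiplicity, of the monic polynomial (function) f.
  -- Over an infinite field, equality of polynomial functions is equality of
  -- polynomials, so σ is then determined up to permutation.
  HasRoots : (Carrier → Carrier) → List Carrier → Set (c ⊔ ℓ)
  HasRoots f σ = ∀ x → f x ≈ foldr (λ a q → (x - a) * q) 1# σ

  IsSpectrum : ∀ {n} → Matrix n → List Carrier → Set (c ⊔ ℓ)
  IsSpectrum {n} M σ = length σ ≡ n × HasRoots (charPoly M) σ

  A : ∀ {n} → Graph n → Matrix n
  A X i j = if adj X i j then 1# else 0#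

-- The properties of the real numbers on which the notion of the spectrum of a
-- graph rests: a field of characteristic zero over which every symmetric matrix
-- has all its eigenvalues. Decidability of _#_ makes it a discrete field; the
-- real algebraic numbers are an example, and so, classically, is ℝ.
record SpectralField (c ℓ₁ ℓ₂ : Level) : Set (lsuc (c ⊔ ℓ₁ ⊔ ℓ₂)) where
  field
    heytingField : HeytingField c ℓ₁ ℓ₂

  open HeytingField heytingField public

  commutativeRing : CommutativeRing c ℓ₁
  commutativeRing = record { isCommutativeRing = isCommutativeRing }

  open Spectrum commutativeRing public

  field
    _#?_                : Decidable _#_
    characteristic-zero : ∀ n → (suc n · 1#) # 0#
    spectral            : ∀ {n} (M : Matrix n) → Symmetric M → ∃ (IsSpectrum M)

{-# OPTIONS --safe #-}
module Submission where

-- Write ρ = x - r₁, N = m - 1, and let B be the characteristic matrix of H₁ at x,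
-- all of whose column sums are ρ. In the characteristic matrix of G, replacing
-- the row of each u in F by ρ times it plus the rows of all pockets attached to u
-- makes the matrix block triangular, whence
--   ρⁿ · χ_G(x) = det (ρ (x I - A(F)) - N D) · det(B)ᵏ,
-- where D is diagonal and counts the pockets at each vertex of F. Shrinking each
-- pocket to a single vertex with a loop of weight r₁ and an edge of weight √N
-- gives a symmetric matrix Q of order n + k with the same first factor, but with
-- ρᵏ in place of det(B)ᵏ. The spectrum of Q is the part independent of H: as
-- det(B) = ρ ∏ (x - t) over t in τ, cancelling ρⁿ leaves χ_G = χ_Q · ∏ (x - t)ᵏ.
-- The same row operation on H itself gives ρ · χ_H(x) = (ρ x - N) · det(B),
-- which identifies τ as the spectrum of H without α and β.

open import Defs
open import Level using (Level; 0ℓ; _⊔_)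
open import Algebra.Bundles using (CommutativeRing; RawRing)
open import Algebra.Solver.Ring.AlmostCommutativeRing
  using (_-Raw-AlmostCommutative⟶_; fromCommutativeRing)
open import Data.Bool.Base using (Bool; true; false; if_then_else_; _∧_)
open import Data.Fin.Base
  using (Fin; zero; suc; toℕ; punchIn; punchOut; splitAt; combine; quotient; _↑ˡ_; _↑ʳ_)
open import Data.Fin.Properties
  using ( _≟_; suc-injective; toℕ-↑ˡ; splitAt-↑ˡ; splitAt-↑ʳ; ↑ˡ-injective; ↑ʳ-injective
        ; punchInᵢ≢i; punchIn-injective; punchIn-punchOut
        ; remQuot-combine; combine-injective; combine-surjective )
open import Data.Fin.Subset using (Subset; ∣_∣; _∈_)
open import Data.Fin.Subset.Properties using (∣p∣≡n⇒p≡⊤)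
open import Data.List.Base using (List; []; _∷_; _++_; foldr; length; concatMap; replicate)
open import Data.List.Properties using (length-++; length-replicate)
open import Data.List.Relation.Binary.Permutation.Setoid using () renaming (_↭_ to Perm)
open import Data.List.Relation.Binary.Pointwise.Base using ([]; _∷_)
open import Data.Maybe.Base using (Maybe; just; nothing)
open import Data.Nat.Base using (ℕ; zero; suc; _≤_; _∸_; s≤s; z≤n) renaming (_+_ to _ℕ+_; _*_ to _ℕ*_)
open import Data.Product.Base using (_×_; _,_; proj₁; proj₂; ∃; ∃-syntax)
open import Data.Sum.Base using (_⊎_; inj₁; inj₂; [_,_]; map₂)
open import Data.Vec.Base using (tabulate; lookup)
open import Data.Vec.Functional using (Vector; removeAt) renaming (_∷_ to _◂_)
open import Data.Vec.Properties using (lookup∘tabulate; lookup-replicate)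
open import Function.Bundles using (_⇔_)
open import Relation.Binary.PropositionalEquality.Core using (_≡_; _≢_)
open import Relation.Nullary.Decidable.Core using (⌊_⌋; yes; no)
open import Relation.Nullary.Negation.Core using (¬_; contradiction)
import Algebra.Properties.AbelianGroup as AbelianGroupProperties
import Algebra.Properties.Ring as RingProperties
import Algebra.Properties.Semiring.Exp as Exponentiation
import Algebra.Properties.Semiring.Mult as SemiringMult
import Algebra.Properties.Semiring.Mult.TCOptimised as Multiples
import Algebra.Properties.Semiring.Sum as SemiringSum
import Algebra.Solver.Ring
import Algebra.Solver.Ring.NaturalCoefficients.Default as NaturalSolver
import Data.List.Relation.Binary.Permutation.Setoid as SetoidPermutation
import Data.List.Relation.Binary.Permutation.Setoid.Properties as SetoidPermutationProperties
import Data.Nat.Properties as ℕₚ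
import Relation.Binary.PropositionalEquality.Core as ≡
import Relation.Binary.Reasoning.Setoid as SetoidReasoning

-- A ring solver whose integer coefficients are differences of natural numbers.

module Solver {c ℓ : Level} (R : CommutativeRing c ℓ) where
  open CommutativeRing R
  open Multiples semiring using (×-homo-+; ×1-homo-*) renaming (_×_ to _×′_)
  open RingProperties ring using (-0#≈0#; -‿distribˡ-*; -‿distribʳ-*; -‿involutive; ⁻¹-anti-homo‿-)
  open AbelianGroupProperties +-abelianGroup using (⁻¹-∙-comm)
  open SetoidReasoning setoid

  reduce : ℕ × ℕ → ℕ × ℕ
  reduce (suc a , suc b) = reduce (a , b)
  reduce p               = p

  -- Coefficients are kept in lowest terms, since the solver compares normal
  -- forms by computation.
  Difference : RawRing 0ℓ 0ℓ
  Difference = record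
    { Carrier = ℕ × ℕ
    ; _≈_     = _≡_
    ; _+_     = λ (a , b) (c , d) → reduce (a ℕ+ c , b ℕ+ d)
    ; _*_     = λ (a , b) (c , d) → reduce (a ℕ* c ℕ+ b ℕ* d , a ℕ* d ℕ+ b ℕ* c)
    ; -_      = λ (a , b) → b , a
    ; 0#      = 0 , 0
    ; 1#      = 1 , 0
    }

  ι : ℕ → Carrier
  ι n = n ×′ 1#

  -- The case split makes ⟦ 0 , 0 ⟧ and ⟦ 1 , 0 ⟧ reduce to 0# and 1#.
  ⟦_⟧ : ℕ × ℕ → Carrier
  ⟦ a , zero ⟧  = ι a
  ⟦ a , suc b ⟧ = ι a - ι (suc b)

  ⟦⟧-diff : ∀ a b → ⟦ a , b ⟧ ≈ ι a - ι b
  ⟦⟧-diff a zero    = sym (trans (+-congˡ -0#≈0#) (+-identityʳ _))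
  ⟦⟧-diff a (suc b) = refl

  private
    module N = NaturalSolver commutativeSemiring

  ⟦⟧-+ : ∀ a b c d → ⟦ a ℕ+ c , b ℕ+ d ⟧ ≈ ⟦ a , b ⟧ + ⟦ c , d ⟧
  ⟦⟧-+ a b c d = begin
    ⟦ a ℕ+ c , b ℕ+ d ⟧
      ≈⟨ ⟦⟧-diff (a ℕ+ c) (b ℕ+ d) ⟩
    ι (a ℕ+ c) - ι (b ℕ+ d)
      ≈⟨ +-cong (×-homo-+ 1# a c) (trans (-‿cong (×-homo-+ 1# b d)) (sym (⁻¹-∙-comm (ι b) (ι d)))) ⟩
    (ι a + ι c) + (- ι b + - ι d)
      ≈⟨ N.solve 4 (λ x y z w → (x N.:+ y) N.:+ (z N.:+ w) N.:= (x N.:+ z) N.:+ (y N.:+ w)) refl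
           (ι a) (ι c) (- ι b) (- ι d) ⟩
    (ι a - ι b) + (ι c - ι d)
      ≈⟨ +-cong (⟦⟧-diff a b) (⟦⟧-diff c d) ⟨
    ⟦ a , b ⟧ + ⟦ c , d ⟧ ∎

  ⟦⟧-* : ∀ a b c d → ⟦ a ℕ* c ℕ+ b ℕ* d , a ℕ* d ℕ+ b ℕ* c ⟧ ≈ ⟦ a , b ⟧ * ⟦ c , d ⟧
  ⟦⟧-* a b c d = begin
    ⟦ a ℕ* c ℕ+ b ℕ* d , a ℕ* d ℕ+ b ℕ* c ⟧
      ≈⟨ ⟦⟧-diff (a ℕ* c ℕ+ b ℕ* d) (a ℕ* d ℕ+ b ℕ* c) ⟩
    ι (a ℕ* c ℕ+ b ℕ* d) - ι (a ℕ* d ℕ+ b ℕ* c)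
      ≈⟨ +-cong (ι-sum a c b d) (trans (-‿cong (ι-sum a d b c)) (sym (⁻¹-∙-comm _ _))) ⟩
    (ι a * ι c + ι b * ι d) + (- (ι a * ι d) + - (ι b * ι c))
      ≈⟨ +-cong (+-congˡ (sym (trans (sym (-‿distribˡ-* _ _)) (trans (-‿cong (sym (-‿distribʳ-* _ _)))
            (-‿involutive _)))))
           (+-cong (-‿distribʳ-* _ _) (-‿distribˡ-* _ _)) ⟩
    (ι a * ι c + - ι b * - ι d) + (ι a * - ι d + - ι b * ι c)
      ≈⟨ N.solve 4 (λ x y z w → (x N.:* z N.:+ y N.:* w) N.:+ (x N.:* w N.:+ y N.:* z) N.:=
            (x N.:+ y) N.:* (z N.:+ w)) refl
           (ι a) (- ι b) (ι c) (- ι d) ⟩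
    (ι a - ι b) * (ι c - ι d)
      ≈⟨ *-cong (⟦⟧-diff a b) (⟦⟧-diff c d) ⟨
    ⟦ a , b ⟧ * ⟦ c , d ⟧ ∎
    where
    ι-sum : ∀ a c b d → ι (a ℕ* c ℕ+ b ℕ* d) ≈ ι a * ι c + ι b * ι d
    ι-sum a c b d = trans (×-homo-+ 1# (a ℕ* c) (b ℕ* d)) (+-cong (×1-homo-* a c) (×1-homo-* b d))

  ⟦⟧-neg : ∀ a b → ⟦ b , a ⟧ ≈ - ⟦ a , b ⟧
  ⟦⟧-neg a b = begin
    ⟦ b , a ⟧       ≈⟨ ⟦⟧-diff b a ⟩
    ι b - ι a       ≈⟨ ⁻¹-anti-homo‿- (ι a) (ι b) ⟨
    - (ι a - ι b)   ≈⟨ -‿cong (⟦⟧-diff a b) ⟨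
    - ⟦ a , b ⟧     ∎

  -- Follows by inserting `ι d - ι d`. It serves twice: for the soundness of `reduce`, and as the
  -- equality test on coefficients in the solver.
  ⟦⟧-≈ : ∀ a b c d → a ℕ+ d ≡ c ℕ+ b → ⟦ a , b ⟧ ≈ ⟦ c , d ⟧
  ⟦⟧-≈ a b c d a+d≡c+b = begin
    ⟦ a , b ⟧                    ≈⟨ ⟦⟧-diff a b ⟩
    ι a - ι b                    ≈⟨ +-congʳ (move a d) ⟩
    ((ι a + ι d) - ι d) - ι b    ≈⟨ +-congʳ (+-congʳ (trans (sym (×-homo-+ 1# a d)) (trans (reflexive
          (≡.cong ι a+d≡c+b)) (×-homo-+ 1# c b)))) ⟩
    ((ι c + ι b) - ι d) - ι b    ≈⟨ N.solve 4 (λ x y z w → ((x N.:+ y) N.:+ z) N.:+ w N.:= (x N.:+ z) N.:+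
          (y N.:+ w)) refl (ι c) (ι b) (- ι d) (- ι b) ⟩
    (ι c - ι d) + (ι b - ι b)    ≈⟨ +-congˡ (-‿inverseʳ _) ⟩
    (ι c - ι d) + 0#             ≈⟨ +-identityʳ _ ⟩
    ι c - ι d                    ≈⟨ ⟦⟧-diff c d ⟨
    ⟦ c , d ⟧                    ∎
    where
    move : ∀ a d → ι a ≈ (ι a + ι d) - ι d
    move a d = sym (trans (+-assoc _ _ _) (trans (+-congˡ (-‿inverseʳ _)) (+-identityʳ _)))

  ⟦⟧-reduce : ∀ a b → ⟦ reduce (a , b) ⟧ ≈ ⟦ a , b ⟧
  ⟦⟧-reduce zero    b       = refl
  ⟦⟧-reduce (suc a) zero    = refl
  ⟦⟧-reduce (suc a) (suc b) = trans (⟦⟧-reduce a b) (⟦⟧-≈ a b (suc a) (suc b) (ℕₚ.+-suc a b))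

  evaluation : Difference -Raw-AlmostCommutative⟶ fromCommutativeRing R
  evaluation = record
    { ⟦_⟧    = ⟦_⟧
    ; +-homo = λ (a , b) (c , d) → trans (⟦⟧-reduce (a ℕ+ c) (b ℕ+ d)) (⟦⟧-+ a b c d)
    ; *-homo = λ (a , b) (c , d) →
        trans (⟦⟧-reduce (a ℕ* c ℕ+ b ℕ* d) (a ℕ* d ℕ+ b ℕ* c)) (⟦⟧-* a b c d)
    ; -‿homo = λ (a , b) → ⟦⟧-neg a b
    ; 0-homo = refl
    ; 1-homo = refl
    }

  _≟ᶜ_ : ∀ (p q : ℕ × ℕ) → Maybe (⟦ p ⟧ ≈ ⟦ q ⟧)
  (a , b) ≟ᶜ (c , d) with a ℕ+ d ℕₚ.≟ c ℕ+ b
  ... | yes eq = just (⟦⟧-≈ a b c d eq)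
  ... | no  _  = nothing

  open Algebra.Solver.Ring Difference (fromCommutativeRing R) evaluation _≟ᶜ_ public
    using (Polynomial; solve; con; _:+_; _:*_; :-_; _:-_; _:=_)

  :0 :1 : ∀ {n} → Polynomial n
  :0 = con (0 , 0)
  :1 = con (1 , 0)

-- Determinants by first-row expansion: alternation, row operations, block triangular matrices.

punchIn-↑ˡ : ∀ {m} n (j : Fin (suc m)) (w : Fin m) → punchIn (j ↑ˡ n) (w ↑ˡ n) ≡ punchIn j w ↑ˡ n
punchIn-↑ˡ n zero    w       = ≡.refl
punchIn-↑ˡ n (suc j) zero    = ≡.refl
punchIn-↑ˡ n (suc j) (suc w) = ≡.cong suc (punchIn-↑ˡ n j w)

-- Together with `punchIn-↑ˡ`: striking out a column of the left block leaves a matrix split into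
-- blocks in the same way, as the induction in `Det-blockTriangular` requires.
punchIn-↑ʳ : ∀ {m n} (j : Fin (suc m)) (y : Fin n) → punchIn (j ↑ˡ n) (m ↑ʳ y) ≡ suc m ↑ʳ y
punchIn-↑ʳ         zero    y = ≡.refl
punchIn-↑ʳ {suc m} (suc j) y = ≡.cong suc (punchIn-↑ʳ j y)

module Determinant {c ℓ : Level} (R : CommutativeRing c ℓ) where
  open CommutativeRing R hiding (zero)
  open Solver R
  open Spectrum R
  open SemiringSum semiring using
    ( sum-cong-≋; sum-remove; ∑-distrib-+; *-distribˡ-sum; *-distribʳ-sum
    ; sum-replicate; sum-replicate-zero )
  open RingProperties ring using (-0#≈0#; x∙y⁻¹≈ε⇒x≈y)
  open SetoidReasoning setoid

  sgn : ∀ {n} → Fin n → Carrier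
  sgn j = (- 1#) ^ toℕ j

  Row : ℕ → Set c
  Row = Vector Carrier

  -- Opaque copies of sum and det: the originals unfold at a successor size, and
  -- then unification cannot recover their arguments.
  opaque
    ∑ : ∀ {n} → (Fin n → Carrier) → Carrier
    ∑ = sum

    ∑-suc : ∀ {n} (f : Fin (suc n) → Carrier) → ∑ f ≈ f zero + ∑ (λ i → f (suc i))
    ∑-suc f = refl

    ∑-cong : ∀ {n} {f g : Fin n → Carrier} → (∀ i → f i ≈ g i) → ∑ f ≈ ∑ g
    ∑-cong = sum-cong-≋

    ∑-const : ∀ n x → ∑ {n} (λ _ → x) ≈ n · x
    ∑-const n x = sum-replicate n

    ∑-zero : ∀ {n} {f : Fin n → Carrier} → (∀ i → f i ≈ 0#) → ∑ f ≈ 0#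
    ∑-zero {n} f≈0 = trans (sum-cong-≋ f≈0) (sum-replicate-zero n)

    ∑-single : ∀ {n} (f : Fin n → Carrier) i → (∀ j → j ≢ i → f j ≈ 0#) → ∑ f ≈ f i
    ∑-single {suc n} f i f≈0 = begin
      sum f                       ≈⟨ sum-remove {i = i} f ⟩
      f i + sum (removeAt f i)    ≈⟨ +-congˡ (∑-zero λ j → f≈0 (punchIn i j) (punchInᵢ≢i i j)) ⟩
      f i + 0#                    ≈⟨ +-identityʳ _ ⟩
      f i                         ∎

    ∑-+ : ∀ {n} (f g : Fin n → Carrier) → ∑ (λ i → f i + g i) ≈ ∑ f + ∑ g
    ∑-+ = ∑-distrib-+

    ∑-comm : ∀ {m n} (f : Fin m → Fin n → Carrier) → ∑ (λ i → ∑ (f i)) ≈ ∑ (λ j → ∑ λ i → f i j)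
    ∑-comm = SemiringSum.∑-comm semiring

    *-∑ : ∀ {n} x (f : Fin n → Carrier) → x * ∑ f ≈ ∑ (λ i → x * f i)
    *-∑ = *-distribˡ-sum

    ∑-* : ∀ {n} x (f : Fin n → Carrier) → ∑ f * x ≈ ∑ (λ i → f i * x)
    ∑-* = *-distribʳ-sum

    ∑-++ : ∀ m {n} (f : Fin (m ℕ+ n) → Carrier) → ∑ f ≈ ∑ (λ i → f (i ↑ˡ n)) + ∑ (λ j → f (m ↑ʳ j))
    ∑-++ zero    f = sym (+-identityˡ _)
    ∑-++ (suc m) f = trans (+-congˡ (∑-++ m (λ i → f (suc i)))) (sym (+-assoc _ _ _))

    ∑-combine : ∀ m n (f : Fin (m ℕ* n) → Carrier) → ∑ f ≈ ∑ {m} λ i → ∑ {n} λ j → f (combine i j)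
    ∑-combine zero    n f = refl
    ∑-combine (suc m) n f = trans (∑-++ n f) (+-congˡ (∑-combine m n (λ j → f (n ↑ʳ j))))

  -- Only a column is struck out, since `X` consists of the rows below the one being expanded.
  minor : ∀ {m n} → (Fin m → Row (suc n)) → Fin (suc n) → Fin m → Row n
  minor X j a b = X a (punchIn j b)

  opaque
    unfolding ∑

    Det : ∀ {n} → Matrix n → Carrier
    Det = det

    Det≈det : ∀ {n} (M : Matrix n) → Det M ≈ det M
    Det≈det M = refl

    Det-zero : (M : Matrix zero) → Det M ≈ 1#
    Det-zero M = refl

    Det-suc : ∀ {n} (M : Matrix (suc n)) → Det M ≈ ∑ λ j → sgn j * (M zero j * Det (minor (λ a → M (suc a)) j))
    Det-suc M = refl

    Det-cong : ∀ {n} {M N : Matrix n} → (∀ a b → M a b ≈ N a b) → Det M ≈ Det N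
    Det-cong {zero}  M≈N = refl
    Det-cong {suc n} M≈N = ∑-cong λ j →
      *-congˡ {x = sgn j} (*-cong (M≈N zero j) (Det-cong λ a b → M≈N (suc a) (punchIn j b)))

  -- Expanding Det along its first two rows gives such a double sum, where φ
  -- enumerates the remaining columns.
  symmetric-pairs : ∀ {n} (g : Fin (2 ℕ+ n) → Fin (2 ℕ+ n) → (Fin n → Fin (2 ℕ+ n)) → Carrier) →
    (∀ a b {φ ψ} → (∀ c → φ c ≡ ψ c) → g a b φ ≈ g b a ψ) →
    ∑ (λ j → sgn j * ∑ λ l → sgn l * g j (punchIn j l) (λ c → punchIn j (punchIn l c))) ≈ 0#
  symmetric-pairs {n} g g-sym = begin
    ∑ (λ j → sgn j * ∑ λ l → sgn l * g j (punchIn j l) (λ c → punchIn j (punchIn l c)))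
      ≈⟨ ∑-suc _ ⟩
    1# * P + ∑ (λ j → sgn (suc j) * ∑ λ l → sgn l * g (suc j) (punchIn (suc j) l) (λ c → punchIn (suc j)
          (punchIn l c)))
      ≈⟨ +-cong (*-identityˡ P) (∑-cong expand) ⟩
    P + ∑ (λ j → - 1# * (sgn j * u j) + sgn j * ∑ λ l → sgn l * h j l)
      ≈⟨ +-congˡ (∑-+ _ _) ⟩
    P + (∑ (λ j → - 1# * (sgn j * u j)) + ∑ λ j → sgn j * ∑ λ l → sgn l * h j l)
      ≈⟨ +-congˡ (+-congʳ (*-∑ (- 1#) _)) ⟨
    P + (- 1# * ∑ (λ j → sgn j * u j) + ∑ λ j → sgn j * ∑ λ l → sgn l * h j l)
      -- Column zero is chosen first in `P` and second in `u`. Symmetry of `g` identifies the terms,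
      -- and their signs are opposite.
      ≈⟨ +-cong (∑-cong λ j → *-congˡ {x = sgn j} (g-sym zero (suc j) λ _ → ≡.refl)) (+-congˡ (rest n g g-sym)) ⟩
    ∑ (λ j → sgn j * u j) + (- 1# * ∑ (λ j → sgn j * u j) + 0#)
      ≈⟨ solve 1 (λ s → s :+ (:- :1 :* s :+ :0) := :0) refl _ ⟩
    0# ∎
    where
    P : Carrier
    P = ∑ λ l → sgn l * g zero (suc l) (λ c → suc (punchIn l c))

    u : Fin (suc n) → Carrier
    u j = g (suc j) zero (λ c → suc (punchIn j c))

    h : Fin (suc n) → Fin n → Carrier
    h j l = g (suc j) (suc (punchIn j l)) (λ c → punchIn (suc j) (punchIn (suc l) c))

    expand : ∀ j → sgn (suc j) * ∑ (λ l → sgn l * g (suc j) (punchIn (suc j) l) (λ c → punchIn (suc j) (punchIn l c)))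
                 ≈ - 1# * (sgn j * u j) + sgn j * ∑ λ l → sgn l * h j l
    expand j = begin
      sgn (suc j) * ∑ (λ l → sgn l * g (suc j) (punchIn (suc j) l) (λ c → punchIn (suc j) (punchIn l c)))
        ≈⟨ *-congˡ (∑-suc _) ⟩
      sgn (suc j) * (1# * u j + ∑ λ l → (- 1# * sgn l) * h j l)
        ≈⟨ *-congˡ (+-congˡ (trans (∑-cong λ l → *-assoc (- 1#) (sgn l) (h j l)) (sym (*-∑ (- 1#) _)))) ⟩
      sgn (suc j) * (1# * u j + - 1# * ∑ λ l → sgn l * h j l)
        ≈⟨ solve 3 (λ s x y → (:- :1 :* s) :* (:1 :* x :+ :- :1 :* y) := :- :1 :* (s :* x) :+ s :* y)
             refl (sgn j) (u j) _ ⟩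
      - 1# * (sgn j * u j) + sgn j * ∑ (λ l → sgn l * h j l) ∎

    -- When neither chosen column is zero, column zero always stays among the remaining ones. This
    -- is therefore the same kind of double sum with one column fewer, and the two lemmas recurse
    -- into each other.
    rest : ∀ n (g : Fin (2 ℕ+ n) → Fin (2 ℕ+ n) → (Fin n → Fin (2 ℕ+ n)) → Carrier) →
      (∀ a b {φ ψ} → (∀ c → φ c ≡ ψ c) → g a b φ ≈ g b a ψ) →
      ∑ (λ j → sgn j * ∑ λ l → sgn l * g (suc j) (suc (punchIn j l)) (λ c → punchIn (suc j) (punchIn (suc l) c))) ≈ 0#
    rest zero    g g-sym = ∑-zero λ j → trans (*-congˡ {x = sgn j} (∑-zero λ ())) (zeroʳ (sgn j))
    rest (suc n) g g-sym = trans
      (∑-cong λ j → *-congˡ {x = sgn j} (∑-cong λ l → *-congˡ {x = sgn l}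
        -- Applying the symmetry twice restores the order of the two columns, but replaces the
        -- enumeration by the pointwise equal `lift`; no function extensionality is involved.
        (trans (g-sym (suc j) (suc (punchIn j l)) λ _ → ≡.refl) (g-sym (suc (punchIn j l)) (suc j)
              (lift-punchIn j l)))))
      (symmetric-pairs (λ a b φ → g (suc a) (suc b) (lift φ)) λ a b eq → g-sym (suc a) (suc b) (lift-cong eq))
      where
      lift : (Fin n → Fin (2 ℕ+ n)) → Fin (suc n) → Fin (3 ℕ+ n)
      lift φ zero    = zero
      lift φ (suc c) = suc (φ c)

      lift-cong : ∀ {φ ψ} → (∀ c → φ c ≡ ψ c) → ∀ c → lift φ c ≡ lift ψ c
      lift-cong eq zero    = ≡.refl
      lift-cong eq (suc c) = ≡.cong suc (eq c)

      lift-punchIn : ∀ j l c → punchIn (suc j) (punchIn (suc l) c) ≡ lift (λ c → punchIn j (punchIn l c)) c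
      lift-punchIn j l zero    = ≡.refl
      lift-punchIn j l (suc c) = ≡.refl

  module _ {n : ℕ} (X : Fin n → Row (2 ℕ+ n)) where

    private
      columns : (Fin n → Fin (2 ℕ+ n)) → Carrier
      columns φ = Det λ a b → X a (φ b)

      columns-cong : ∀ {φ ψ} → (∀ c → φ c ≡ ψ c) → columns φ ≈ columns ψ
      columns-cong eq = Det-cong λ a b → reflexive (≡.cong (X a) (eq b))

      -- The expansion along two rows, with the product of their entries generalised to an arbitrary
      -- weight, so that expansions can be added and tested for symmetry.
      pairs : ((a b : Fin (2 ℕ+ n)) → Carrier) → Carrier
      pairs w = ∑ λ j → sgn j * ∑ λ l → sgn l * (w j (punchIn j l) * columns λ c → punchIn j (punchIn l c))

      expand₂ : ∀ r s → Det (r ◂ s ◂ X) ≈ pairs (λ a b → r a * s b)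
      expand₂ r s = trans (Det-suc (r ◂ s ◂ X)) (∑-cong λ j → *-congˡ {x = sgn j} (begin
        r j * Det (minor (s ◂ X) j)
          ≈⟨ *-congˡ (Det-suc (minor (s ◂ X) j)) ⟩
        r j * ∑ (λ l → sgn l * (s (punchIn j l) * columns λ c → punchIn j (punchIn l c)))
          ≈⟨ *-∑ (r j) _ ⟩
        ∑ (λ l → r j * (sgn l * (s (punchIn j l) * columns λ c → punchIn j (punchIn l c))))
          ≈⟨ ∑-cong (λ l → solve 4 (λ x y z w → x :* (y :* (z :* w)) := y :* (x :* z :* w))
               refl (r j) (sgn l) (s (punchIn j l)) _) ⟩
        ∑ (λ l → sgn l * (r j * s (punchIn j l) * columns λ c → punchIn j (punchIn l c))) ∎))

      pairs-+ : ∀ v w → pairs v + pairs w ≈ pairs (λ a b → v a b + w a b)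
      pairs-+ v w = trans (sym (∑-+ _ _)) (∑-cong λ j →
        trans (sym (distribˡ (sgn j) _ _)) (*-congˡ {x = sgn j} (trans (sym (∑-+ _ _)) (∑-cong λ l →
          solve 4 (λ s x y m → s :* (x :* m) :+ s :* (y :* m) := s :* ((x :+ y) :* m))
            refl (sgn l) (v j (punchIn j l)) (w j (punchIn j l)) _))))

      pairs-symmetric : ∀ w → (∀ a b → w a b ≈ w b a) → pairs w ≈ 0#
      pairs-symmetric w w-sym = symmetric-pairs (λ a b φ → w a b * columns φ) λ a b eq → *-cong
            (w-sym a b) (columns-cong eq)

    -- Equal rows make the weight `r a * s b` symmetric. The argument is direct because antisymmetry
    -- alone would not suffice in a ring where 2 is a zero divisor.
    Det-equal₂ : ∀ r s → (∀ c → r c ≈ s c) → Det (r ◂ s ◂ X) ≈ 0#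
    Det-equal₂ r s r≈s = trans (expand₂ r s)
      (pairs-symmetric _ λ a b → trans (*-cong (r≈s a) (sym (r≈s b))) (*-comm (s a) (r b)))

    -- The two expansions add up to one whose weight is symmetric in the two columns.
    Det-swap₂ : ∀ r s → Det (r ◂ s ◂ X) ≈ - Det (s ◂ r ◂ X)
    Det-swap₂ r s = x∙y⁻¹≈ε⇒x≈y _ _ (begin
      Det (r ◂ s ◂ X) - - Det (s ◂ r ◂ X)
        ≈⟨ solve 2 (λ x y → x :- :- y := x :+ y) refl _ _ ⟩
      Det (r ◂ s ◂ X) + Det (s ◂ r ◂ X)
        ≈⟨ +-cong (expand₂ r s) (expand₂ s r) ⟩
      pairs (λ a b → r a * s b) + pairs (λ a b → s a * r b)
        ≈⟨ pairs-+ (λ a b → r a * s b) (λ a b → s a * r b) ⟩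
      pairs (λ a b → r a * s b + s a * r b)
        ≈⟨ pairs-symmetric _ (λ a b → solve 4 (λ ra rb sa sb → ra :* sb :+ sa :* rb := rb :* sa :+ sb :* ra)
             refl (r a) (r b) (s a) (s b)) ⟩
      0# ∎)

  Det-expand-zero : ∀ {n} (M : Matrix (suc n)) → (∀ j → M zero j * Det (minor (λ a → M (suc a)) j) ≈ 0#) → Det M ≈ 0#
  Det-expand-zero M eq = trans (Det-suc M) (∑-zero λ j → trans (*-congˡ {x = sgn j} (eq j)) (zeroʳ (sgn j)))

  -- If the repeated row is not the second one, the first two rows are swapped. Every minor along
  -- the new first row then has `r` on top and its duplicate below, so induction applies.
  Det-equal : ∀ {n} (r : Row (suc n)) (X : Fin n → Row (suc n)) j → (∀ c → r c ≈ X j c) → Det (r ◂ X) ≈ 0#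
  Det-equal {suc n}       r X zero    r≈Xj = trans
    (Det-cong λ { zero b → refl ; (suc zero) b → refl ; (suc (suc a)) b → refl })
    (Det-equal₂ (λ a → X (suc a)) r (X zero) r≈Xj)
  Det-equal {suc (suc n)} r X (suc j) r≈Xj = begin
    Det (r ◂ X)
      ≈⟨ Det-cong (λ { zero b → refl ; (suc zero) b → refl ; (suc (suc a)) b → refl }) ⟩
    Det (r ◂ X zero ◂ λ a → X (suc a))
      ≈⟨ Det-swap₂ (λ a → X (suc a)) r (X zero) ⟩
    - Det (X zero ◂ r ◂ λ a → X (suc a))
      ≈⟨ -‿cong (Det-expand-zero (X zero ◂ r ◂ λ a → X (suc a)) λ c → trans (*-congˡ (trans
           (Det-cong λ { zero b → refl ; (suc a) b → refl })
           (Det-equal (λ b → r (punchIn c b)) (minor (λ a → X (suc a)) c) j λ b → r≈Xj (punchIn c b)))) (zeroʳ _)) ⟩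
    - 0#
      ≈⟨ -0#≈0# ⟩
    0# ∎

  moveToTop : ∀ {n} → Fin (suc n) → Fin (suc n) → Fin (suc n)
  moveToTop i = i ◂ punchIn i

  -- One swap brings row zero back to the top at the cost of a sign. Each minor below it is a minor
  -- of `M` with its row `i` moved to the top, which induction handles.
  Det-moveToTop : ∀ {n} (M : Matrix (suc n)) i → Det (λ a → M (moveToTop i a)) ≈ sgn i * Det M
  Det-moveToTop         M zero    = trans (Det-cong λ { zero b → refl ; (suc a) b → refl }) (sym
        (*-identityˡ (Det M)))
  Det-moveToTop {suc n} M (suc i) = begin
    Det (λ a → M (moveToTop (suc i) a))
      ≈⟨ Det-cong (λ { zero b → refl ; (suc zero) b → refl ; (suc (suc a)) b → refl }) ⟩
    Det (M (suc i) ◂ M zero ◂ λ a → M (suc (punchIn i a)))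
      ≈⟨ Det-swap₂ (λ a → M (suc (punchIn i a))) (M (suc i)) (M zero) ⟩
    - Det (M zero ◂ M (suc i) ◂ λ a → M (suc (punchIn i a)))
      ≈⟨ -‿cong (trans (Det-suc (M zero ◂ M (suc i) ◂ λ a → M (suc (punchIn i a)))) (trans (∑-cong expand)
            (sym (*-∑ (sgn i) _)))) ⟩
    - (sgn i * ∑ λ j → sgn j * (M zero j * Det (M′ j)))
      ≈⟨ -‿cong (*-congˡ (Det-suc M)) ⟨
    - (sgn i * Det M)
      ≈⟨ solve 2 (λ s d → :- (s :* d) := (:- :1 :* s) :* d) refl _ _ ⟩
    (- 1# * sgn i) * Det M ∎
    where
    M′ : Fin (2 ℕ+ n) → Matrix (suc n)
    M′ = minor λ a → M (suc a)

    expand : ∀ j → sgn j * (M zero j * Det (minor (M (suc i) ◂ λ a → M (suc (punchIn i a))) j))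
                 ≈ sgn i * (sgn j * (M zero j * Det (M′ j)))
    expand j = trans
      (*-congˡ {x = sgn j} (*-congˡ (trans (Det-cong λ { zero b → refl ; (suc a) b → refl })
            (Det-moveToTop (M′ j) i))))
      (solve 4 (λ x y z w → x :* (y :* (z :* w)) := z :* (x :* (y :* w)))
        refl (sgn j) (M zero j) (sgn i) _)

  -- Linearity in the first row: each added row contributes a determinant with a repeated row.
  -- Scaling by `ρ` is part of the operation, so that no division by `ρ` occurs.
  Det-row-op : ∀ {n N} ρ (a : Fin N → Carrier) (h : Fin N → Fin n) (r : Row (suc n)) (X : Fin n → Row (suc n)) →
    Det ((λ c → ρ * r c + ∑ λ y → a y * X (h y) c) ◂ X) ≈ ρ * Det (r ◂ X)
  Det-row-op {n} ρ a h r X = begin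
    Det ((λ c → ρ * r c + ∑ λ y → a y * X (h y) c) ◂ X)
      ≈⟨ Det-suc _ ⟩
    ∑ (λ j → sgn j * ((ρ * r j + ∑ λ y → a y * X (h y) j) * D j))
      ≈⟨ ∑-cong split ⟩
    ∑ (λ j → ρ * (sgn j * (r j * D j)) + ∑ λ y → a y * (sgn j * (X (h y) j * D j)))
      ≈⟨ ∑-+ _ _ ⟩
    ∑ (λ j → ρ * (sgn j * (r j * D j))) + ∑ (λ j → ∑ λ y → a y * (sgn j * (X (h y) j * D j)))
      ≈⟨ +-cong (sym (*-∑ ρ _)) (∑-comm _) ⟩
    ρ * ∑ (λ j → sgn j * (r j * D j)) + ∑ (λ y → ∑ λ j → a y * (sgn j * (X (h y) j * D j)))
      ≈⟨ +-cong (*-congˡ (sym (Det-suc (r ◂ X)))) (∑-zero vanish) ⟩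
    ρ * Det (r ◂ X) + 0#
      ≈⟨ +-identityʳ _ ⟩
    ρ * Det (r ◂ X) ∎
    where
    D : Fin (suc n) → Carrier
    D j = Det (minor X j)

    split : ∀ j → sgn j * ((ρ * r j + ∑ λ y → a y * X (h y) j) * D j)
                ≈ ρ * (sgn j * (r j * D j)) + ∑ λ y → a y * (sgn j * (X (h y) j * D j))
    split j = begin
      sgn j * ((ρ * r j + ∑ λ y → a y * X (h y) j) * D j)
        ≈⟨ solve 5 (λ s p r t m → s :* ((p :* r :+ t) :* m) := p :* (s :* (r :* m)) :+ s :* m :* t)
             refl (sgn j) ρ (r j) _ (D j) ⟩
      ρ * (sgn j * (r j * D j)) + sgn j * D j * ∑ (λ y → a y * X (h y) j)
        ≈⟨ +-congˡ (trans (*-∑ (sgn j * D j) _) (∑-cong λ y →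
             solve 4 (λ s m a x → (s :* m) :* (a :* x) := a :* (s :* (x :* m)))
               refl (sgn j) (D j) (a y) (X (h y) j))) ⟩
      ρ * (sgn j * (r j * D j)) + ∑ (λ y → a y * (sgn j * (X (h y) j * D j))) ∎

    vanish : ∀ y → ∑ (λ j → a y * (sgn j * (X (h y) j * D j))) ≈ 0#
    vanish y = begin
      ∑ (λ j → a y * (sgn j * (X (h y) j * D j)))   ≈⟨ *-∑ (a y) _ ⟨
      a y * ∑ (λ j → sgn j * (X (h y) j * D j))     ≈⟨ *-congˡ (Det-suc (X (h y) ◂ X)) ⟨
      a y * Det (X (h y) ◂ X)                       ≈⟨ *-congˡ (Det-equal (X (h y)) X (h y) λ _ → refl) ⟩
      a y * 0#                                      ≈⟨ zeroʳ (a y) ⟩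
      0#                                            ∎

  -- The first row is treated by `Det-row-op` in the matrix whose other top rows are already
  -- modified, which is harmless as only bottom rows are added. The other top rows are treated
  -- inside each minor by induction.
  Det-row-ops : ∀ n {N} ρ (a : Fin n → Fin N → Carrier) (M M′ : Matrix (n ℕ+ N)) →
    (∀ u c → M′ (u ↑ˡ N) c ≈ ρ * M (u ↑ˡ N) c + ∑ λ y → a u y * M (n ↑ʳ y) c) →
    (∀ y c → M′ (n ↑ʳ y) c ≈ M (n ↑ʳ y) c) →
    Det M′ ≈ ρ ^ n * Det M
  Det-row-ops zero    ρ a M M′ top bottom = trans (Det-cong bottom) (sym (*-identityˡ _))
  Det-row-ops (suc n) {N} ρ a M M′ top bottom = begin
    Det M′
      ≈⟨ Det-cong (λ { zero c → trans (top zero c) (+-congˡ (∑-cong λ y → *-congˡ (sym (bottom y c)))) ;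
            (suc b) c → refl }) ⟩
    Det ((λ c → ρ * M zero c + ∑ λ y → a zero y * M′ (suc (n ↑ʳ y)) c) ◂ X′)
      ≈⟨ Det-row-op ρ (a zero) (n ↑ʳ_) (M zero) X′ ⟩
    ρ * Det (M zero ◂ X′)
      ≈⟨ *-congˡ (trans (Det-suc (M zero ◂ X′)) (∑-cong expand)) ⟩
    ρ * ∑ (λ j → ρ ^ n * (sgn j * (M zero j * Det (minor X j))))
      ≈⟨ *-congˡ (trans (*-congˡ (Det-suc M)) (*-∑ (ρ ^ n) _)) ⟨
    ρ * (ρ ^ n * Det M)
      ≈⟨ *-assoc _ _ _ ⟨
    ρ ^ suc n * Det M ∎
    where
    X X′ : Fin (n ℕ+ N) → Row (suc n ℕ+ N)
    X  b = M (suc b)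
    X′ b = M′ (suc b)

    expand : ∀ j → sgn j * (M zero j * Det (minor X′ j)) ≈ ρ ^ n * (sgn j * (M zero j * Det (minor X j)))
    expand j = trans
      (*-congˡ {x = sgn j} (*-congˡ (Det-row-ops n ρ (λ u → a (suc u)) (minor X j) (minor X′ j)
        (λ u c → top (suc u) (punchIn j c)) (λ y c → bottom y (punchIn j c)))))
      (solve 4 (λ s m p d → s :* (m :* (p :* d)) := p :* (s :* (m :* d)))
        refl (sgn j) (M zero j) (ρ ^ n) _)

  -- The first row is zero outside the left block, so only left columns contribute to its expansion,
  -- and each of their minors is block triangular with the same lower right block.
  Det-blockTriangular : ∀ n {N} (M : Matrix (n ℕ+ N)) → (∀ u y → M (u ↑ˡ N) (n ↑ʳ y) ≈ 0#) →
    Det M ≈ Det (λ u w → M (u ↑ˡ N) (w ↑ˡ N)) * Det (λ y z → M (n ↑ʳ y) (n ↑ʳ z))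
  Det-blockTriangular zero        M M≈0 = sym (trans (*-congʳ (Det-zero _)) (*-identityˡ _))
  Det-blockTriangular (suc n) {N} M M≈0 = begin
    Det M
      ≈⟨ trans (Det-suc M) (∑-++ (suc n) _) ⟩
    ∑ (λ j → sgn (j ↑ˡ N) * (M zero (j ↑ˡ N) * Det (minor X (j ↑ˡ N)))) +
    ∑ (λ y → sgn (suc n ↑ʳ y) * (M zero (suc n ↑ʳ y) * Det (minor X (suc n ↑ʳ y))))
      ≈⟨ +-cong (∑-cong left) (∑-zero λ y → trans (*-congˡ {x = sgn (suc n ↑ʳ y)} (trans (*-congʳ
            (M≈0 zero y)) (zeroˡ _))) (zeroʳ (sgn (suc n ↑ʳ y)))) ⟩
    ∑ (λ j → sgn j * (M zero (j ↑ˡ N) * Det (minor X₁ j)) * D) + 0#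
      ≈⟨ trans (+-identityʳ _) (sym (∑-* D _)) ⟩
    ∑ (λ j → sgn j * (M zero (j ↑ˡ N) * Det (minor X₁ j))) * D
      ≈⟨ *-congʳ (Det-suc λ u w → M (u ↑ˡ N) (w ↑ˡ N)) ⟨
    Det (λ u w → M (u ↑ˡ N) (w ↑ˡ N)) * D ∎
    where
    X : Fin (n ℕ+ N) → Row (suc n ℕ+ N)
    X a = M (suc a)

    X₁ : Fin n → Row (suc n)
    X₁ u w = M (suc (u ↑ˡ N)) (w ↑ˡ N)

    D : Carrier
    D = Det λ y z → M (suc n ↑ʳ y) (suc n ↑ʳ z)

    left : ∀ j → sgn (j ↑ˡ N) * (M zero (j ↑ˡ N) * Det (minor X (j ↑ˡ N)))
               ≈ sgn j * (M zero (j ↑ˡ N) * Det (minor X₁ j)) * D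
    left j = begin
      sgn (j ↑ˡ N) * (M zero (j ↑ˡ N) * Det (minor X (j ↑ˡ N)))
        ≈⟨ *-cong (reflexive (≡.cong ((- 1#) ^_) (toℕ-↑ˡ j N))) (*-congˡ (trans
             (Det-blockTriangular n (minor X (j ↑ˡ N)) λ u y → trans (reflexive (≡.cong (M (suc (u ↑ˡ N)))
                   (punchIn-↑ʳ j y))) (M≈0 (suc u) y))
             (*-cong (Det-cong λ a b → reflexive (≡.cong (M (suc (a ↑ˡ N))) (punchIn-↑ˡ N j b)))
                     (Det-cong λ y z → reflexive (≡.cong (M (suc n ↑ʳ y)) (punchIn-↑ʳ j z)))))) ⟩
      sgn j * (M zero (j ↑ˡ N) * (Det (minor X₁ j) * D))
        ≈⟨ solve 4 (λ s m e d → s :* (m :* (e :* d)) := s :* (m :* e) :* d) refl (sgn j) _ _ _ ⟩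
      sgn j * (M zero (j ↑ˡ N) * Det (minor X₁ j)) * D ∎

-- Determinants of matrices with the shape of a graph with pockets or of a cone.

module PocketDeterminant {c ℓ : Level} (R : CommutativeRing c ℓ) where
  open CommutativeRing R hiding (zero)
  open Solver R
  open Spectrum R
  open Determinant R
  open SemiringMult semiring using (×-assoc-*; ×-congʳ)
  open SetoidReasoning setoid

  scalar-refl : ∀ {n} x (i : Fin n) → scalar x i i ≈ x
  scalar-refl x i with i ≟ i
  ... | yes _  = refl
  ... | no i≢i = contradiction ≡.refl i≢i

  scalar-≢ : ∀ {n} x {i j : Fin n} → i ≢ j → scalar x i j ≈ 0#
  scalar-≢ x {i} {j} i≢j with i ≟ j
  ... | yes i≡j = contradiction i≡j i≢j
  ... | no _    = refl

  scalar-injective : ∀ {m n} x (f : Fin m → Fin n) → (∀ i j → f i ≡ f j → i ≡ j) →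
    ∀ i j → scalar x (f i) (f j) ≈ scalar x i j
  scalar-injective x f f-inj i j with i ≟ j
  ... | yes ≡.refl = scalar-refl x (f i)
  ... | no i≢j     = scalar-≢ x (λ eq → i≢j (f-inj i j eq))

  δ : ∀ {n} → Fin n → Fin n → Carrier
  δ = scalar 1#

  ∑-δ : ∀ {n} (f : Fin n → Carrier) j → ∑ (λ i → f i * δ i j) ≈ f j
  ∑-δ f j = begin
    ∑ (λ i → f i * δ i j)   ≈⟨ ∑-single _ j (λ i i≢j → trans (*-congˡ (scalar-≢ 1# i≢j)) (zeroʳ (f i))) ⟩
    f j * δ j j             ≈⟨ *-congˡ (scalar-refl 1# j) ⟩
    f j * 1#                ≈⟨ *-identityʳ (f j) ⟩
    f j                     ∎

  ·≈* : ∀ n x → n · x ≈ (n · 1#) * x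
  ·≈* n x = sym (trans (×-assoc-* n 1# x) (×-congʳ n (*-identityˡ x)))

  -- `combine zero x` and `combine (suc i) x` compute to indices in the first block and in the
  -- remainder, so the blocks split off one at a time.
  Det-blockDiagonal : ∀ k {N} (B : Matrix N) (M : Matrix (k ℕ* N)) →
    (∀ (i : Fin k) x j y → M (combine i x) (combine j y) ≈ δ i j * B x y) → Det M ≈ Det B ^ k
  Det-blockDiagonal zero        B M blocks = Det-zero M
  Det-blockDiagonal (suc k) {N} B M blocks = begin
    Det M
      ≈⟨ Det-blockTriangular N M upper ⟩
    Det (λ x y → M (x ↑ˡ (k ℕ* N)) (y ↑ˡ (k ℕ* N))) * Det (λ x y → M (N ↑ʳ x) (N ↑ʳ y))
      ≈⟨ *-cong (Det-cong λ x y → trans (blocks zero x zero y) (*-identityˡ (B x y)))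
                (Det-blockDiagonal k B _ λ i x j y →
                  trans (blocks (suc i) x (suc j) y) (*-congʳ (scalar-injective 1# suc
                        (λ _ _ → suc-injective) i j))) ⟩
    Det B * Det B ^ k ∎
    where
    upper : ∀ x z → M (x ↑ˡ (k ℕ* N)) (N ↑ʳ z) ≈ 0#
    upper x z with combine-surjective {k} {N} z
    ... | j , y , ≡.refl = trans (blocks zero x (suc j) y) (zeroˡ (B x y))

  -- Adding to ρ times the row of each F-vertex u the rows of all pockets at u,
  -- weighted by s, clears the upper right block.
  pocket-Det : ∀ {n k N} (p : Fin k → Fin n) (C : Matrix n) (B : Matrix N) ρ s (M : Matrix (n ℕ+ k ℕ* N)) →
    (∀ u w → M (u ↑ˡ (k ℕ* N)) (w ↑ˡ (k ℕ* N)) ≈ C u w) →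
    (∀ u i x → M (u ↑ˡ (k ℕ* N)) (n ↑ʳ combine i x) ≈ - (s * δ u (p i))) →
    (∀ u i x → M (n ↑ʳ combine i x) (u ↑ˡ (k ℕ* N)) ≈ - (s * δ u (p i))) →
    (∀ i x j y → M (n ↑ʳ combine i x) (n ↑ʳ combine j y) ≈ δ i j * B x y) →
    (∀ y → ∑ (λ x → B x y) ≈ ρ) →
    ρ ^ n * Det M ≈
      Det (λ u w → ρ * C u w - ((N · 1#) * (s * s)) * ∑ λ i → δ u (p i) * δ w (p i)) * Det B ^ k
  pocket-Det {n} {k} {N} p C B ρ s M M₁₁ M₁₂ M₂₁ M₂₂ B-sum = begin
    ρ ^ n * Det M
      ≈⟨ Det-row-ops n ρ a M M′ M′₁ M′₂ ⟨
    Det M′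
      ≈⟨ Det-blockTriangular n M′ M′₁₂ ⟩
    Det (λ u w → M′ (u ↑ˡ K) (w ↑ˡ K)) * Det (λ y z → M′ (n ↑ʳ y) (n ↑ʳ z))
      ≈⟨ *-cong (Det-cong M′₁₁) (Det-blockDiagonal k B _ λ i x j y → trans (M′₂ _ _) (M₂₂ i x j y)) ⟩
    Det (λ u w → ρ * C u w - ((N · 1#) * (s * s)) * ∑ λ i → δ u (p i) * δ w (p i)) * Det B ^ k ∎
    where
    K : ℕ
    K = k ℕ* N

    a : Fin n → Fin K → Carrier
    a u z = s * δ u (p (quotient {k} N z))

    M′ : Matrix (n ℕ+ K)
    M′ b c = [ (λ u → ρ * M (u ↑ˡ K) c + ∑ λ z → a u z * M (n ↑ʳ z) c) , (λ z → M (n ↑ʳ z) c) ] (splitAt n b)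

    M′₁ : ∀ u c → M′ (u ↑ˡ K) c ≈ ρ * M (u ↑ˡ K) c + ∑ λ z → a u z * M (n ↑ʳ z) c
    M′₁ u c = reflexive (≡.cong [ _ , _ ] (splitAt-↑ˡ n u K))

    M′₂ : ∀ z c → M′ (n ↑ʳ z) c ≈ M (n ↑ʳ z) c
    M′₂ z c = reflexive (≡.cong [ _ , _ ] (splitAt-↑ʳ n K z))

    added : ∀ u c → ∑ (λ z → a u z * M (n ↑ʳ z) c) ≈ ∑ λ i → ∑ λ x → s * δ u (p i) * M (n ↑ʳ combine i x) c
    added u c = trans (∑-combine k N _) (∑-cong λ i → ∑-cong λ x →
      *-congʳ (*-congˡ (reflexive (≡.cong (λ q → δ u (p (proj₁ q))) (remQuot-combine i x)))))

    M′₁₁ : ∀ u w → M′ (u ↑ˡ K) (w ↑ˡ K) ≈ ρ * C u w - ((N · 1#) * (s * s)) * ∑ λ i → δ u (p i) * δ w (p i)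
    M′₁₁ u w = begin
      M′ (u ↑ˡ K) (w ↑ˡ K)
        ≈⟨ M′₁ u (w ↑ˡ K) ⟩
      ρ * M (u ↑ˡ K) (w ↑ˡ K) + ∑ (λ z → a u z * M (n ↑ʳ z) (w ↑ˡ K))
        -- Each of the `N` rows of a pocket at both `u` and `w` contributes weight `s` times entry
        -- `- s`, whence the factor `N s²`.
        ≈⟨ +-cong (*-congˡ (M₁₁ u w)) (trans (added u (w ↑ˡ K)) (∑-cong pocket)) ⟩
      ρ * C u w + ∑ (λ i → - ((N · 1#) * (s * s)) * (δ u (p i) * δ w (p i)))
        ≈⟨ +-congˡ (*-∑ _ _) ⟨
      ρ * C u w + - ((N · 1#) * (s * s)) * ∑ (λ i → δ u (p i) * δ w (p i))
        ≈⟨ solve 3 (λ x y z → x :+ :- y :* z := x :- y :* z) refl _ _ _ ⟩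
      ρ * C u w - ((N · 1#) * (s * s)) * ∑ (λ i → δ u (p i) * δ w (p i)) ∎
      where
      pocket : ∀ i → ∑ (λ x → s * δ u (p i) * M (n ↑ʳ combine i x) (w ↑ˡ K)) ≈ - ((N · 1#) * (s * s)) *
            (δ u (p i) * δ w (p i))
      pocket i = begin
        ∑ (λ x → s * δ u (p i) * M (n ↑ʳ combine i x) (w ↑ˡ K))    ≈⟨ ∑-cong (λ x → *-congˡ (M₂₁ w i x)) ⟩
        ∑ {N} (λ _ → s * δ u (p i) * - (s * δ w (p i)))            ≈⟨ trans (∑-const N _) (·≈* N _) ⟩
        (N · 1#) * (s * δ u (p i) * - (s * δ w (p i)))
          ≈⟨ solve 4 (λ N s d e → N :* (s :* d :* :- (s :* e)) := :- (N :* (s :* s)) :* (d :* e))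
               refl (N · 1#) s _ _ ⟩
        - ((N · 1#) * (s * s)) * (δ u (p i) * δ w (p i))           ∎

    M′₁₂ : ∀ u z → M′ (u ↑ˡ K) (n ↑ʳ z) ≈ 0#
    M′₁₂ u z with combine-surjective {k} {N} z
    ... | j , y , ≡.refl = begin
      M′ (u ↑ˡ K) (n ↑ʳ combine j y)
        ≈⟨ M′₁ u _ ⟩
      ρ * M (u ↑ˡ K) (n ↑ʳ combine j y) + ∑ (λ z → a u z * M (n ↑ʳ z) (n ↑ʳ combine j y))
        -- Only the rows of pocket `j` meet this column outside zero blocks. The column sum of `B`
        -- is `ρ`, so what they add is exactly opposite to `ρ` times the original entry.
        ≈⟨ +-cong (*-congˡ (M₁₂ u j y)) (trans (added u _) (∑-cong pocket)) ⟩
      ρ * - (s * δ u (p j)) + ∑ (λ i → s * δ u (p i) * ρ * δ i j)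
        ≈⟨ +-congˡ (∑-δ (λ i → s * δ u (p i) * ρ) j) ⟩
      ρ * - (s * δ u (p j)) + s * δ u (p j) * ρ
        ≈⟨ solve 3 (λ r s d → r :* :- (s :* d) :+ s :* d :* r := :0) refl ρ s _ ⟩
      0# ∎
      where
      pocket : ∀ i → ∑ (λ x → s * δ u (p i) * M (n ↑ʳ combine i x) (n ↑ʳ combine j y)) ≈ s * δ u (p i) * ρ * δ i j
      pocket i = begin
        ∑ (λ x → s * δ u (p i) * M (n ↑ʳ combine i x) (n ↑ʳ combine j y))
          ≈⟨ ∑-cong (λ x → trans (*-congˡ (M₂₂ i x j y))
               (solve 3 (λ x y z → x :* (y :* z) := x :* y :* z) refl (s * δ u (p i)) (δ i j) (B x y))) ⟩
        ∑ (λ x → s * δ u (p i) * δ i j * B x y)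
          ≈⟨ trans (sym (*-∑ _ _)) (*-congˡ (B-sum y)) ⟩
        s * δ u (p i) * δ i j * ρ
          ≈⟨ solve 3 (λ x y z → x :* y :* z := x :* z :* y) refl _ _ ρ ⟩
        s * δ u (p i) * ρ * δ i j ∎

  sgn-square : ∀ {n} (i : Fin n) → sgn i * sgn i ≈ 1#
  sgn-square zero    = *-identityˡ 1#
  sgn-square (suc i) = trans (solve 1 (λ s → (:- :1 :* s) :* (:- :1 :* s) := s :* s)
    refl (sgn i)) (sgn-square i)

  -- Row `v` is replaced by `ρ` times itself plus all other rows. The column sums of `B` then cancel
  -- every entry of it except the one in column `v`, so the expansion has a single term. Moving the
  -- row to the top and expanding at column `v` give the same sign twice.
  cone-Det : ∀ {N} (M : Matrix (suc N)) v (B : Matrix N) ρ x →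
    M v v ≈ x →
    (∀ y → M v (punchIn v y) ≈ - 1#) →
    (∀ y → M (punchIn v y) v ≈ - 1#) →
    (∀ y z → M (punchIn v y) (punchIn v z) ≈ B y z) →
    (∀ z → ∑ (λ y → B y z) ≈ ρ) →
    ρ * Det M ≈ (ρ * x - N · 1#) * Det B
  cone-Det {N} M v B ρ x Mᵥᵥ Mᵥ₂ M₂ᵥ M₂₂ B-sum = begin
    ρ * Det M
      ≈⟨ cancel (ρ * Det M) ⟨
    sgn v * (sgn v * (ρ * Det M))
      ≈⟨ *-congˡ (solve 3 (λ s r d → s :* (r :* d) := r :* (s :* d)) refl (sgn v) ρ _) ⟩
    sgn v * (ρ * (sgn v * Det M))
      ≈⟨ *-congˡ (*-congˡ (trans (sym (Det-moveToTop M v)) (Det-cong λ { zero b → refl ; (suc a) b → refl }))) ⟩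
    sgn v * (ρ * Det (M v ◂ X))
      ≈⟨ *-congˡ (Det-row-op ρ (λ _ → 1#) (λ y → y) (M v) X) ⟨
    sgn v * Det (r ◂ X)
      ≈⟨ *-congˡ (trans (Det-suc (r ◂ X)) (∑-single _ v other)) ⟩
    sgn v * (sgn v * (r v * Det (minor X v)))
      ≈⟨ cancel _ ⟩
    r v * Det (minor X v)
      ≈⟨ *-cong rᵥ (Det-cong M₂₂) ⟩
    (ρ * x - N · 1#) * Det B ∎
    where
    X : Fin N → Row (suc N)
    X y = M (punchIn v y)

    r : Row (suc N)
    r c = ρ * M v c + ∑ λ y → 1# * X y c

    cancel : ∀ t → sgn v * (sgn v * t) ≈ t
    cancel t = trans (sym (*-assoc _ _ t)) (trans (*-congʳ (sgn-square v)) (*-identityˡ t))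

    rᵥ : r v ≈ ρ * x - N · 1#
    rᵥ = begin
      r v                                 ≈⟨ +-cong (*-congˡ Mᵥᵥ) (trans (∑-cong λ y → trans
            (*-identityˡ _) (M₂ᵥ y)) (trans (∑-const N (- 1#)) (·≈* N (- 1#)))) ⟩
      ρ * x + (N · 1#) * - 1#             ≈⟨ solve 2 (λ y n → y :+ n :* :- :1 := y :- n)
        refl (ρ * x) (N · 1#) ⟩
      ρ * x - N · 1#                      ∎

    other : ∀ j → j ≢ v → sgn j * (r j * Det (minor X j)) ≈ 0#
    other j j≢v = trans (*-congˡ {x = sgn j} (trans (*-congʳ r≈0) (zeroˡ _))) (zeroʳ (sgn j))
      where
      v≢j : v ≢ j
      v≢j eq = j≢v (≡.sym eq)

      z : Fin N
      z = punchOut v≢j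

      r≈0 : r j ≈ 0#
      r≈0 = begin
        r j                                  ≈⟨ reflexive (≡.cong r (punchIn-punchOut v≢j)) ⟨
        r (punchIn v z)                      ≈⟨ +-cong (*-congˡ (Mᵥ₂ z)) (∑-cong λ y → trans
              (*-identityˡ _) (M₂₂ y z)) ⟩
        ρ * - 1# + ∑ (λ y → B y z)           ≈⟨ +-congˡ (B-sum z) ⟩
        ρ * - 1# + ρ                         ≈⟨ solve 1 (λ r → r :* :- :1 :+ r := :0) refl ρ ⟩
        0#                                   ∎

-- Neighbours of the cone vertex and the indexing of pocket vertices.

∣tabulate∣-punchIn : ∀ {n} (f : Fin (suc n) → Bool) v → f v ≡ false →
  ∣ tabulate f ∣ ≡ ∣ tabulate (λ y → f (punchIn v y)) ∣
∣tabulate∣-punchIn         f zero    fv rewrite fv = ≡.refl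
∣tabulate∣-punchIn {suc n} f (suc v) fv with f zero
... | true  = ≡.cong suc (∣tabulate∣-punchIn (λ y → f (suc y)) v fv)
... | false = ∣tabulate∣-punchIn (λ y → f (suc y)) v fv

∣tabulate∣-full : ∀ {n} (f : Fin n → Bool) → ∣ tabulate f ∣ ≡ n → ∀ y → f y ≡ true
∣tabulate∣-full {n} f eq y = ≡.trans (≡.sym (lookup∘tabulate f y))
  (≡.trans (≡.cong (λ p → lookup p y) (∣p∣≡n⇒p≡⊤ {p = tabulate f} eq)) (lookup-replicate y true))

-- As `v` is not its own neighbour, its `N` neighbours exhaust the other `N` vertices.
cone-adj : ∀ {N} (H : Graph (suc N)) v → degree H v ≡ N → ∀ y → adj H v (punchIn v y) ≡ true
cone-adj H v eq = ∣tabulate∣-full _ (≡.trans (≡.sym (∣tabulate∣-punchIn (adj H v) v (adj-irr H v))) eq)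

module _ {n k m : ℕ} (F : Graph n) (p : Fin k → Fin n) (H : Graph m) (v : Fin m) where

  vertex-↑ˡ : ∀ u → vertex F p H v (u ↑ˡ _) ≡ inj₁ u
  vertex-↑ˡ u = ≡.cong (map₂ _) (splitAt-↑ˡ n u _)

  vertex-↑ʳ : ∀ i x → vertex F p H v (n ↑ʳ combine i x) ≡ inj₂ (i , x)
  vertex-↑ʳ i x = ≡.trans (≡.cong (map₂ _) (splitAt-↑ʳ n _ _)) (≡.cong inj₂ (remQuot-combine i x))

-- Characteristic polynomials of the cone, the graph with pockets and the quotient matrix.

module GraphPolynomial {c ℓ : Level} (R : CommutativeRing c ℓ) where
  open CommutativeRing R hiding (zero)
  open Solver R
  open Spectrum R
  open Determinant R
  open PocketDeterminant R
  open Exponentiation semiring using (^-congˡ)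
  open SetoidReasoning setoid

  scalar-sym : ∀ {n} x → Symmetric (scalar {n} x)
  scalar-sym x i j with i ≟ j
  ... | yes ≡.refl = sym (scalar-refl x i)
  ... | no i≢j     = sym (scalar-≢ x (λ eq → i≢j (≡.sym eq)))

  scalar-combine : ∀ {k N} x (i j : Fin k) (a b : Fin N) → scalar x (combine i a) (combine j b) ≈ δ i j * scalar x a b
  scalar-combine x i j a b with i ≟ j
  ... | yes ≡.refl = trans
    (scalar-injective x (combine i) (λ a b eq → proj₂ (combine-injective i a i b eq)) a b)
    (sym (*-identityˡ _))
  ... | no i≢j = trans
    (scalar-≢ x (λ eq → i≢j (proj₁ (combine-injective i a j b eq))))
    (sym (zeroˡ _))

  ↑ˡ≢↑ʳ : ∀ {n K} (u : Fin n) (z : Fin K) → u ↑ˡ K ≢ n ↑ʳ z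
  ↑ˡ≢↑ʳ {n} {K} u z eq with ≡.trans (≡.sym (splitAt-↑ˡ n u K)) (≡.trans (≡.cong (splitAt n) eq) (splitAt-↑ʳ n K z))
  ... | ()

  ↑ʳ≢↑ˡ : ∀ {n K} (u : Fin n) (z : Fin K) → n ↑ʳ z ≢ u ↑ˡ K
  ↑ʳ≢↑ˡ u z eq = ↑ˡ≢↑ʳ u z (≡.sym eq)

  ∑-neg : ∀ {n} (f : Fin n → Carrier) → ∑ (λ i → - f i) ≈ - ∑ f
  ∑-neg f = begin
    ∑ (λ i → - f i)        ≈⟨ ∑-cong (λ i → solve 1 (λ t → :- t := :- :1 :* t) refl (f i)) ⟩
    ∑ (λ i → - 1# * f i)   ≈⟨ *-∑ (- 1#) f ⟨
    - 1# * ∑ f             ≈⟨ solve 1 (λ t → :- :1 :* t := :- t) refl _ ⟩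
    - ∑ f                  ∎

  indicator : Bool → Carrier
  indicator b = if b then 1# else 0#

  ∑-indicator : ∀ {n} (f : Fin n → Bool) → ∑ (λ y → indicator (f y)) ≈ ∣ tabulate f ∣ · 1#
  ∑-indicator {zero}  f = ∑-zero λ ()
  ∑-indicator {suc n} f = trans (∑-suc _) (trans (+-congˡ (∑-indicator (λ y → f (suc y)))) step)
    where
    step : indicator (f zero) + ∣ tabulate (λ y → f (suc y)) ∣ · 1# ≈ ∣ tabulate f ∣ · 1#
    step with f zero
    ... | true  = refl
    ... | false = +-identityˡ _

  indicator-∧ : ∀ a b → indicator (a ∧ b) ≈ indicator a * indicator b
  indicator-∧ true  b = sym (*-identityˡ _)
  indicator-∧ false b = sym (zeroˡ _)

  A-sym : ∀ {n} (X : Graph n) → Symmetric (A X)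
  A-sym X i j = reflexive (≡.cong indicator (adj-sym X i j))

  χ : ∀ {n} → Matrix n → Carrier → Matrix n
  χ M x i j = scalar x i j - M i j

  -- By symmetry a column sum of the adjacency matrix is a row sum, that is, a degree.
  χ-column-sum : ∀ {n} (X : Graph n) r x → Regular r X → ∀ z → ∑ (λ y → χ (A X) x y z) ≈ x - r · 1#
  χ-column-sum X r x regular z = begin
    ∑ (λ y → scalar x y z - A X y z)            ≈⟨ ∑-+ _ _ ⟩
    ∑ (λ y → scalar x y z) + ∑ (λ y → - A X y z)
      ≈⟨ +-cong (trans (∑-single _ z λ _ → scalar-≢ x) (scalar-refl x z)) (∑-neg _) ⟩
    x - ∑ (λ y → A X y z)
      ≈⟨ +-congˡ (-‿cong (trans (∑-cong λ y → A-sym X y z) (trans (∑-indicator (adj X z)) (reflexive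
            (≡.cong (_· 1#) (regular z)))))) ⟩
    x - r · 1# ∎

  module _ {N : ℕ} (H : Graph (suc N)) (v : Fin (suc N)) (r : ℕ)
           (v-cone : degree H v ≡ N) (regular : Regular r (delete H v)) where

    A-cone : ∀ y → A H v (punchIn v y) ≈ 1#
    A-cone y = reflexive (≡.cong indicator (cone-adj H v v-cone y))

    charPoly-cone : ∀ x → (x - r · 1#) * charPoly (A H) x ≈ ((x - r · 1#) * x - N · 1#) * charPoly (A (delete H v)) x
    charPoly-cone x = trans (*-congˡ (sym (Det≈det _))) (trans
      (cone-Det (χ (A H) x) v (χ (A (delete H v)) x) (x - r · 1#) x
        (trans (+-cong (scalar-refl x v) (-‿cong (reflexive (≡.cong indicator (adj-irr H v)))))
          (solve 1 (λ x → x :- :0 := x) refl x))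
        (λ y → trans (+-cong (scalar-≢ x (λ eq → punchInᵢ≢i v y (≡.sym eq))) (-‿cong (A-cone y))) (+-identityˡ _))
        (λ y → trans (+-cong (scalar-≢ x (punchInᵢ≢i v y)) (-‿cong (trans (A-sym H _ v) (A-cone y)))) (+-identityˡ _))
        (λ y z → +-congʳ (scalar-injective x (punchIn v) (λ i j → punchIn-injective v i j) y z))
        (χ-column-sum (delete H v) r x regular))
      (*-congˡ (Det≈det _)))

  module _ {n k : ℕ} (F : Graph n) (p : Fin k → Fin n) where

    -- The matrix `ρ (x I - A(F)) - t D`: the sum over `i` is the entry of the diagonal matrix `D`
    -- counting the pockets at each vertex. The parameter `t` stands for the sum of the squared edge
    -- weights of one pocket.
    reduced : Carrier → Carrier → Carrier → Matrix n
    reduced t ρ x u w = ρ * χ (A F) x u w - t * ∑ λ i → δ u (p i) * δ w (p i)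

    module _ {N : ℕ} (H : Graph (suc N)) (v : Fin (suc N)) (r : ℕ)
             (v-cone : degree H v ≡ N) (regular : Regular r (delete H v)) where

      private
        K : ℕ
        K = k ℕ* N

        G : Graph (n ℕ+ K)
        G = pockets F p H v

        A-pockets : ∀ {a b a′ b′} → vertex F p H v a ≡ a′ → vertex F p H v b ≡ b′ →
          A G a b ≈ indicator (pocketAdj F p H v a′ b′)
        A-pockets ≡.refl ≡.refl = refl

        attached : ∀ u i x → indicator (⌊ u ≟ p i ⌋ ∧ adj H v (punchIn v x)) ≈ 1# * δ u (p i)
        attached u i x = trans (indicator-∧ ⌊ u ≟ p i ⌋ _) (trans (*-congˡ
              (A-cone H v r v-cone regular x)) (*-comm _ _))

      -- The case of `pocket-Det` with unit edge weights; the product `1# * 1#` is its `s * s`.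
      charPoly-pockets : ∀ x → (x - r · 1#) ^ n * charPoly (A G) x ≈
        Det (reduced ((N · 1#) * (1# * 1#)) (x - r · 1#) x) * charPoly (A (delete H v)) x ^ k
      charPoly-pockets x = trans (*-congˡ (sym (Det≈det _)))
        (trans (pocket-Det p (χ (A F) x) (χ (A (delete H v)) x) (x - r · 1#) 1# (χ (A G) x)
          (λ u w → +-cong (scalar-injective x (_↑ˡ K) (↑ˡ-injective K) u w)
                          (-‿cong (A-pockets (vertex-↑ˡ F p H v u) (vertex-↑ˡ F p H v w))))
          (λ u i y → trans (+-cong (scalar-≢ x (↑ˡ≢↑ʳ u (combine i y)))
                                   (-‿cong (trans (A-pockets (vertex-↑ˡ F p H v u)
                                         (vertex-↑ʳ F p H v i y)) (attached u i y))))
                           (+-identityˡ _))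
          (λ u i y → trans (+-cong (scalar-≢ x (↑ʳ≢↑ˡ u (combine i y)))
                                   (-‿cong (trans (A-pockets (vertex-↑ʳ F p H v i y)
                                         (vertex-↑ˡ F p H v u)) (attached u i y))))
                           (+-identityˡ _))
          (λ i y j z → trans (+-cong (trans (scalar-injective x (n ↑ʳ_) (↑ʳ-injective n) (combine i y)
                (combine j z)) (scalar-combine x i j y z))
                                     (-‿cong (trans (A-pockets (vertex-↑ʳ F p H v i y)
                                           (vertex-↑ʳ F p H v j z)) (indicator-∧ ⌊ i ≟ j ⌋ _))))
                             (solve 3 (λ d s a → d :* s :- d :* a := d :* (s :- a)) refl (δ i j) _ _))
          (χ-column-sum (delete H v) r x regular))
        (*-congˡ (^-congˡ k (Det≈det _))))

    -- The matrix Q, where s stands for √N.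
    quotientMatrix : Carrier → Carrier → Matrix (n ℕ+ k ℕ* 1)
    quotientMatrix r s a b = entry (splitAt n a) (splitAt n b)
      where
      entry : Fin n ⊎ Fin (k ℕ* 1) → Fin n ⊎ Fin (k ℕ* 1) → Carrier
      entry (inj₁ u) (inj₁ w) = A F u w
      entry (inj₁ u) (inj₂ z) = s * δ u (p (quotient {k} 1 z))
      entry (inj₂ z) (inj₁ u) = s * δ u (p (quotient {k} 1 z))
      entry (inj₂ y) (inj₂ z) = scalar r y z

    quotientMatrix-sym : ∀ r s → Symmetric (quotientMatrix r s)
    quotientMatrix-sym r s a b with splitAt n a | splitAt n b
    ... | inj₁ u | inj₁ w = A-sym F u w
    ... | inj₁ u | inj₂ z = refl
    ... | inj₂ z | inj₁ u = refl
    ... | inj₂ y | inj₂ z = scalar-sym r y z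

    -- Again `pocket-Det`, now with pockets of size one whose block is the single entry `x - r`.
    -- Indexing by `k ℕ* 1` instead of `k` makes this literally an instance.
    charPoly-quotient : ∀ r s x → (x - r) ^ n * charPoly (quotientMatrix r s) x ≈
      Det (reduced ((1 · 1#) * (s * s)) (x - r) x) * (x - r) ^ k
    charPoly-quotient r s x = trans (*-congˡ (sym (Det≈det _)))
      (trans (pocket-Det p (χ (A F) x) B (x - r) s (χ (quotientMatrix r s) x)
        (λ u w → +-cong (scalar-injective x (_↑ˡ (k ℕ* 1)) (↑ˡ-injective (k ℕ* 1)) u w) (-‿cong (Q₁₁ u w)))
        (λ u i y → trans (+-cong (scalar-≢ x (↑ˡ≢↑ʳ u (combine i y))) (-‿cong (Q₁₂ u i y))) (+-identityˡ _))
        (λ u i y → trans (+-cong (scalar-≢ x (↑ʳ≢↑ˡ u (combine i y)))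
                                 (-‿cong (trans (quotientMatrix-sym r s _ _) (Q₁₂ u i y)))) (+-identityˡ _))
        χ₂₂
        (λ _ → trans (∑-const 1 (x - r)) (+-identityʳ _)))
      (*-congˡ (^-congˡ k (trans (Det≈det _) (solve 1 (λ t → :1 :* (t :* :1) :+ :0 := t)
        refl (x - r))))))
      where
      B : Matrix 1
      B _ _ = x - r

      Q₁₁ : ∀ u w → quotientMatrix r s (u ↑ˡ (k ℕ* 1)) (w ↑ˡ (k ℕ* 1)) ≈ A F u w
      Q₁₁ u w rewrite splitAt-↑ˡ n u (k ℕ* 1) | splitAt-↑ˡ n w (k ℕ* 1) = refl

      Q₁₂ : ∀ u i y → quotientMatrix r s (u ↑ˡ (k ℕ* 1)) (n ↑ʳ combine i y) ≈ s * δ u (p i)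
      Q₁₂ u i y rewrite splitAt-↑ˡ n u (k ℕ* 1) | splitAt-↑ʳ n (k ℕ* 1) (combine i y) =
        reflexive (≡.cong (λ q → s * δ u (p (proj₁ q))) (remQuot-combine i y))

      Q₂₂ : ∀ i (y : Fin 1) j (z : Fin 1) → quotientMatrix r s (n ↑ʳ combine i y) (n ↑ʳ combine j z) ≈ δ i j * r
      Q₂₂ i zero j zero
        rewrite splitAt-↑ʳ n (k ℕ* 1) (combine {k} {1} i zero) | splitAt-↑ʳ n (k ℕ* 1) (combine {k} {1} j zero) =
        scalar-combine r i j zero zero

      χ₂₂ : ∀ i (y : Fin 1) j (z : Fin 1) → χ (quotientMatrix r s) x (n ↑ʳ combine i y)
            (n ↑ʳ combine j z) ≈ δ i j * (x - r)
      χ₂₂ i zero j zero = trans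
        (+-cong (trans (scalar-injective x (n ↑ʳ_) (↑ʳ-injective n) (combine {k} {1} i zero)
              (combine j zero)) (scalar-combine x i j zero zero))
                (-‿cong (Q₂₂ i zero j zero)))
        (solve 3 (λ d s a → d :* s :- d :* a := d :* (s :- a)) refl (δ i j) x r)

-- Spectral fields as integral domains of characteristic zero.

record SpectralDomain {c ℓ : Level} (R : CommutativeRing c ℓ) : Set (c ⊔ ℓ) where
  open CommutativeRing R
  open Spectrum R

  field
    zero-product : ∀ x y → x * y ≈ 0# → x ≈ 0# ⊎ y ≈ 0#
    suc·1≉0      : ∀ n → ¬ suc n · 1# ≈ 0#
    spectral     : ∀ {n} (M : Matrix n) → Symmetric M → ∃ (IsSpectrum M)

spectralDomain : ∀ {c ℓ₁ ℓ₂} (K : SpectralField c ℓ₁ ℓ₂) → SpectralDomain (SpectralField.commutativeRing K)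
spectralDomain K = record
  { zero-product = zero-product
  ; suc·1≉0      = λ n → #⇒≉ (characteristic-zero n)
  ; spectral     = spectral
  }
  where
  open SpectralField K
  open SetoidReasoning setoid

  #⇒≉ : ∀ {x y} → x # y → ¬ x ≈ y
  #⇒≉ x#y x≈y = proj₂ (tight _ _) x≈y x#y

  -- Decidability of apartness separates two cases: by tightness `x` is zero, or it is apart from
  -- zero, and then the inverse of `x - 0#` cancels it.
  zero-product : ∀ x y → x * y ≈ 0# → x ≈ 0# ⊎ y ≈ 0#
  zero-product x y xy≈0 with x #? 0#
  ... | no ¬x#0 = inj₁ (proj₁ (tight x 0#) ¬x#0)
  ... | yes x#0 with #⇒invertible x#0
  ...   | x⁻¹ , x⁻¹x≈1 , _ = inj₂ (begin
    y                       ≈⟨ *-identityˡ y ⟨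
    1# * y                  ≈⟨ *-congʳ x⁻¹x≈1 ⟨
    (x⁻¹ * (x - 0#)) * y    ≈⟨ *-congʳ (*-congˡ (trans (+-congˡ -0#≈0#) (+-identityʳ x))) ⟩
    (x⁻¹ * x) * y           ≈⟨ *-assoc x⁻¹ x y ⟩
    x⁻¹ * (x * y)           ≈⟨ *-congˡ xy≈0 ⟩
    x⁻¹ * 0#                ≈⟨ zeroʳ x⁻¹ ⟩
    0#                      ∎)
    where
    open RingProperties (CommutativeRing.ring commutativeRing) using (-0#≈0#)

-- Polynomial functions, their roots with multiplicity, and square roots of natural numbers.

module Roots {c ℓ : Level} {R : CommutativeRing c ℓ} (D : SpectralDomain R) where
  open CommutativeRing R hiding (zero) renaming (refl to ≈-refl; trans to ≈-trans)
  open Spectrum R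
  open SpectralDomain D
  open Solver R
  open GraphPolynomial R using (χ)
  open RingProperties ring using (x∙y⁻¹≈ε⇒x≈y; +-cancelˡ)
  open SetoidPermutation setoid using (_↭_; refl; prep; swap; trans; ↭-refl; ↭-trans; ↭-prep; ↭-swap; ↭-sym)
  open SetoidReasoning setoid

  1≉0 : ¬ 1# ≈ 0#
  1≉0 1≈0 = suc·1≉0 0 (≈-trans (+-identityʳ 1#) 1≈0)

  ·1-injective : ∀ m n → m · 1# ≈ n · 1# → m ≡ n
  ·1-injective zero    zero    eq = ≡.refl
  ·1-injective zero    (suc n) eq = contradiction (sym eq) (suc·1≉0 n)
  ·1-injective (suc m) zero    eq = contradiction eq (suc·1≉0 m)
  ·1-injective (suc m) (suc n) eq = ≡.cong suc (·1-injective m n (+-cancelˡ 1# _ _ eq))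

  cancel-factor : ∀ {x y} → ¬ x ≈ 0# → x * y ≈ 0# → y ≈ 0#
  cancel-factor {x} {y} x≉0 xy≈0 with zero-product x y xy≈0
  ... | inj₁ x≈0 = contradiction x≈0 x≉0
  ... | inj₂ y≈0 = y≈0

  -- A polynomial function of degree at most d has, at each point, a difference
  -- quotient that is a polynomial function of degree less than d.
  data Poly : (Carrier → Carrier) → Set (c ⊔ ℓ) where
    constant : ∀ {f} b → (∀ x → f x ≈ b) → Poly f
    divided : ∀ {f} (q : Carrier → Carrier → Carrier) → (∀ a → Poly (q a)) →
               (∀ a x → f x ≈ f a + (x - a) * q a x) → Poly f

  Poly-≈ : ∀ {f g} → (∀ x → f x ≈ g x) → Poly f → Poly g
  Poly-≈ f≈g (constant b f≈b)       = constant b (λ x → ≈-trans (sym (f≈g x)) (f≈b x))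
  Poly-≈ f≈g (divided q q-poly f≈) = divided q q-poly λ a x →
    ≈-trans (sym (f≈g x)) (≈-trans (f≈ a x) (+-congʳ (f≈g a)))

  Poly-scale : ∀ {f} b → Poly f → Poly (λ x → b * f x)
  Poly-scale b (constant d f≈d)    = constant (b * d) (λ x → *-congˡ (f≈d x))
  Poly-scale b (divided q q-poly f≈) = divided (λ a x → b * q a x) (λ a → Poly-scale b (q-poly a)) (λ a x →
    ≈-trans (*-congˡ (f≈ a x)) (solve 4 (λ b y u z → b :* (y :+ u :* z) := b :* y :+ u :* (b :* z))
      ≈-refl b _ (x - a) (q a x)))

  Poly-+ : ∀ {f g} → Poly f → Poly g → Poly (λ x → f x + g x)
  Poly-+ (constant b f≈b) (constant d g≈d) = constant (b + d) (λ x → +-cong (f≈b x) (g≈d x))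
  Poly-+ {f} {g} (constant b f≈b) (divided q q-poly g≈) = divided q q-poly λ a x →
    ≈-trans (+-cong (≈-trans (f≈b x) (sym (f≈b a))) (g≈ a x)) (sym (+-assoc _ _ _))
  Poly-+ {f} {g} (divided q q-poly f≈) (constant d g≈d) = divided q q-poly λ a x →
    ≈-trans (+-cong (f≈ a x) (≈-trans (g≈d x) (sym (g≈d a))))
      (solve 3 (λ x y z → (x :+ y) :+ z := (x :+ z) :+ y) ≈-refl _ _ _)
  Poly-+ {f} {g} (divided q q-poly f≈) (divided q′ q′-poly g≈) = divided (λ a x → q a x + q′ a x)
    (λ a → Poly-+ (q-poly a) (q′-poly a)) λ a x →
      ≈-trans (+-cong (f≈ a x) (g≈ a x))
        (solve 5 (λ f g u s t → (f :+ u :* s) :+ (g :+ u :* t) := (f :+ g) :+ u :* (s :+ t))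
          ≈-refl (f a) (g a) (x - a) (q a x) (q′ a x))

  -- The difference quotient comes from splitting `x - b` as `(a - b) + (x - a)`.
  Poly-linear : ∀ {f} b → Poly f → Poly (λ x → (x - b) * f x)
  Poly-linear {f} b f-poly@(constant d f≈d) = divided (λ _ → f) (λ _ → f-poly) λ a x → begin
    (x - b) * f x                        ≈⟨ solve 4 (λ x b a y → (x :- b) :* y := (a :- b) :* y :+
          (x :- a) :* y) ≈-refl x b a (f x) ⟩
    (a - b) * f x + (x - a) * f x        ≈⟨ +-congʳ (*-congˡ (≈-trans (f≈d x) (sym (f≈d a)))) ⟩
    (a - b) * f a + (x - a) * f x        ∎
  Poly-linear {f} b f-poly@(divided q q-poly f≈) = divided (λ a x → f x + (a - b) * q a x)
    (λ a → Poly-+ f-poly (Poly-scale (a - b) (q-poly a))) λ a x → begin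
      (x - b) * f x
        ≈⟨ solve 4 (λ x b a y → (x :- b) :* y := (a :- b) :* y :+ (x :- a) :* y) ≈-refl x b a (f x) ⟩
      (a - b) * f x + (x - a) * f x
        ≈⟨ +-congʳ (*-congˡ (f≈ a x)) ⟩
      (a - b) * (f a + (x - a) * q a x) + (x - a) * f x
        ≈⟨ solve 5 (λ u v y q z → u :* (y :+ v :* q) :+ v :* z := u :* y :+ v :* (z :+ u :* q))
             ≈-refl (a - b) (x - a) (f a) (q a x) (f x) ⟩
      (a - b) * f a + (x - a) * (f x + (a - b) * q a x) ∎

  -- Division by `x - e 0` leaves a quotient of smaller degree. In the absence of zero divisors it
  -- vanishes at all remaining points, so induction applies.
  Poly-vanishes : ∀ {f} → Poly f → (e : ℕ → Carrier) → (∀ i j → e i ≈ e j → i ≡ j) →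
    (∀ i → f (e i) ≈ 0#) → ∀ x → f x ≈ 0#
  Poly-vanishes (constant b f≈b) e e-inj f≈0 x = ≈-trans (f≈b x) (≈-trans (sym (f≈b (e 0))) (f≈0 0))
  Poly-vanishes {f} (divided q q-poly f≈) e e-inj f≈0 x = begin
    f x                                  ≈⟨ f≈ (e 0) x ⟩
    f (e 0) + (x - e 0) * q (e 0) x      ≈⟨ +-cong (f≈0 0) (*-congˡ (q≈0 x)) ⟩
    0# + (x - e 0) * 0#                  ≈⟨ ≈-trans (+-identityˡ _) (zeroʳ _) ⟩
    0#                                   ∎
    where
    q-zero : ∀ i → q (e 0) (e (suc i)) ≈ 0#
    q-zero i = cancel-factor
      (λ e-e≈0 → contradiction (e-inj (suc i) 0 (x∙y⁻¹≈ε⇒x≈y _ _ e-e≈0)) λ ())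
      (begin
        (e (suc i) - e 0) * q (e 0) (e (suc i))             ≈⟨ +-identityˡ _ ⟨
        0# + (e (suc i) - e 0) * q (e 0) (e (suc i))        ≈⟨ +-congʳ (f≈0 0) ⟨
        f (e 0) + (e (suc i) - e 0) * q (e 0) (e (suc i))   ≈⟨ f≈ (e 0) (e (suc i)) ⟨
        f (e (suc i))                                       ≈⟨ f≈0 (suc i) ⟩
        0#                                                  ∎)

    q≈0 : ∀ x → q (e 0) x ≈ 0#
    q≈0 = Poly-vanishes (q-poly (e 0)) (λ i → e (suc i)) (λ i j eq → ℕₚ.suc-injective (e-inj (suc i)
          (suc j) eq)) q-zero

  -- The difference vanishes at a + 1, a + 2, ….
  Poly-cancel-linear : ∀ {f g} → Poly f → Poly g → ∀ a →
    (∀ x → (x - a) * f x ≈ (x - a) * g x) → ∀ x → f x ≈ g x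
  Poly-cancel-linear {f} {g} f-poly g-poly a eq x = x∙y⁻¹≈ε⇒x≈y _ _ (≈-trans
    (solve 2 (λ u v → u :- v := u :+ :- :1 :* v) ≈-refl (f x) (g x))
    (Poly-vanishes (Poly-+ f-poly (Poly-scale (- 1#) g-poly)) (λ i → a + suc i · 1#)
      (λ i j e≈e → ℕₚ.suc-injective (·1-injective (suc i) (suc j) (+-cancelˡ a _ _ e≈e))) vanishes x))
    where
    vanishes : ∀ i → f (a + suc i · 1#) + - 1# * g (a + suc i · 1#) ≈ 0#
    vanishes i = cancel-factor (suc·1≉0 i) (begin
      suc i · 1# * (f y + - 1# * g y)
        ≈⟨ shift a (suc i · 1#) (f y) (g y) ⟩
      (y - a) * f y - (y - a) * g y
        ≈⟨ +-congʳ (eq y) ⟩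
      (y - a) * g y - (y - a) * g y
        ≈⟨ -‿inverseʳ _ ⟩
      0# ∎)
      where
      y : Carrier
      y = a + suc i · 1#

      shift : ∀ a n u v → n * (u + - 1# * v) ≈ ((a + n) - a) * u - ((a + n) - a) * v
      shift = solve 4 (λ a n u v → n :* (u :+ :- :1 :* v) := (a :+ n :- a) :* u :- (a :+ n :- a) :* v) ≈-refl

  -- One factor is cancelled at a time as an identity of polynomial functions. Pointwise
  -- cancellation would fail at `x = a`, so the remaining product must itself be shown polynomial.
  Poly-cancel-power : ∀ {f g} → Poly f → Poly g → ∀ a n →
    (∀ x → (x - a) ^ n * f x ≈ (x - a) ^ n * g x) → ∀ x → f x ≈ g x
  Poly-cancel-power         f-poly g-poly a zero    eq x = ≈-trans (sym (*-identityˡ _)) (≈-trans (eq x)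
        (*-identityˡ _))
  Poly-cancel-power {f} {g} f-poly g-poly a (suc n) eq =
    Poly-cancel-power f-poly g-poly a n (Poly-cancel-linear (power n f-poly) (power n g-poly) a λ x →
      ≈-trans (sym (*-assoc _ _ _)) (≈-trans (eq x) (*-assoc _ _ _)))
    where
    power : ∀ n {f} → Poly f → Poly (λ x → (x - a) ^ n * f x)
    power zero    f-poly = Poly-≈ (λ x → sym (*-identityˡ _)) f-poly
    power (suc n) f-poly = Poly-≈ (λ x → sym (*-assoc _ _ _)) (Poly-linear a (power n f-poly))

  rootPoly : List Carrier → Carrier → Carrier
  rootPoly σ x = foldr (λ a q → (x - a) * q) 1# σ

  rootPoly-Poly : ∀ σ → Poly (rootPoly σ)
  rootPoly-Poly []      = constant 1# (λ _ → ≈-refl)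
  rootPoly-Poly (a ∷ σ) = Poly-linear a (rootPoly-Poly σ)

  rootPoly-at-root : ∀ a σ → rootPoly (a ∷ σ) a ≈ 0#
  rootPoly-at-root a σ = ≈-trans (*-congʳ (-‿inverseʳ a)) (zeroˡ _)

  rootPoly-↭ : ∀ {σ τ} → σ ↭ τ → ∀ x → rootPoly σ x ≈ rootPoly τ x
  rootPoly-↭ (refl [])          x = ≈-refl
  rootPoly-↭ (refl (a≈b ∷ σ≋τ)) x = *-cong (+-congˡ (-‿cong a≈b)) (rootPoly-↭ (refl σ≋τ) x)
  rootPoly-↭ (prep a≈b σ↭τ)     x = *-cong (+-congˡ (-‿cong a≈b)) (rootPoly-↭ σ↭τ x)
  rootPoly-↭ (swap a≈a′ b≈b′ σ↭τ) x = ≈-trans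
    (solve 3 (λ u v w → u :* (v :* w) := v :* (u :* w)) ≈-refl _ _ _)
    (*-cong (+-congˡ (-‿cong b≈b′)) (*-cong (+-congˡ (-‿cong a≈a′)) (rootPoly-↭ σ↭τ x)))
  rootPoly-↭ (trans σ↭τ τ↭υ)    x = ≈-trans (rootPoly-↭ σ↭τ x) (rootPoly-↭ τ↭υ x)

  rootPoly-++ : ∀ σ τ x → rootPoly (σ ++ τ) x ≈ rootPoly σ x * rootPoly τ x
  rootPoly-++ []      τ x = sym (*-identityˡ _)
  rootPoly-++ (a ∷ σ) τ x = ≈-trans (*-congˡ (rootPoly-++ σ τ x)) (sym (*-assoc _ _ _))

  rootPoly-replicate : ∀ k a x → rootPoly (replicate k a) x ≈ (x - a) ^ k
  rootPoly-replicate zero    a x = ≈-refl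
  rootPoly-replicate (suc k) a x = *-congˡ (rootPoly-replicate k a x)

  *-^ : ∀ x y k → (x * y) ^ k ≈ x ^ k * y ^ k
  *-^ x y zero    = sym (*-identityˡ 1#)
  *-^ x y (suc k) = ≈-trans (*-congˡ (*-^ x y k)) (solve 4 (λ x y u v → (x :* y) :* (u :* v) :=
        (x :* u) :* (y :* v)) ≈-refl x y (x ^ k) (y ^ k))

  rootPoly-repeat : ∀ k τ x → rootPoly (concatMap (replicate k) τ) x ≈ rootPoly τ x ^ k
  rootPoly-repeat k []      x = sym (1^k≈1 k)
    where
    1^k≈1 : ∀ k → 1# ^ k ≈ 1#
    1^k≈1 zero    = ≈-refl
    1^k≈1 (suc k) = ≈-trans (*-identityˡ _) (1^k≈1 k)
  rootPoly-repeat k (a ∷ τ) x = begin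
    rootPoly (replicate k a ++ concatMap (replicate k) τ) x
      ≈⟨ rootPoly-++ (replicate k a) (concatMap (replicate k) τ) x ⟩
    rootPoly (replicate k a) x * rootPoly (concatMap (replicate k) τ) x
      ≈⟨ *-cong (rootPoly-replicate k a x) (rootPoly-repeat k τ x) ⟩
    (x - a) ^ k * rootPoly τ x ^ k
      ≈⟨ *-^ (x - a) (rootPoly τ x) k ⟨
    ((x - a) * rootPoly τ x) ^ k ∎

  length-repeat : ∀ k (τ : List Carrier) → length (concatMap (replicate k) τ) ≡ length τ ℕ* k
  length-repeat k []      = ≡.refl
  length-repeat k (a ∷ τ) = ≡.trans (length-++ (replicate k a)) (≡.cong₂ _ℕ+_ (length-replicate k)
        (length-repeat k τ))

  -- A product vanishes only if a factor does, so the root is found by going through the list.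
  extract-root : ∀ a σ → rootPoly σ a ≈ 0# → ∃[ τ ] σ ↭ a ∷ τ
  extract-root a []      1≈0 = contradiction 1≈0 1≉0
  extract-root a (b ∷ σ) eq with zero-product (a - b) (rootPoly σ a) eq
  ... | inj₁ a-b≈0 = σ , prep (sym (x∙y⁻¹≈ε⇒x≈y a b a-b≈0)) ↭-refl
  ... | inj₂ σa≈0 with extract-root a σ σa≈0
  ...   | τ , σ↭aτ = b ∷ τ , ↭-trans (↭-prep b σ↭aτ) (↭-swap b a ↭-refl)

  -- Unique factorisation: the head of `σ` is a root of the other product, is brought to its front
  -- and is cancelled there as a linear factor.
  rootPoly-injective : ∀ σ τ → (∀ x → rootPoly σ x ≈ rootPoly τ x) → σ ↭ τ
  rootPoly-injective []      []      eq = ↭-refl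
  rootPoly-injective []      (b ∷ τ) eq = contradiction (≈-trans (eq b) (rootPoly-at-root b τ)) 1≉0
  rootPoly-injective (a ∷ σ) τ       eq with extract-root a τ (≈-trans (sym (eq a)) (rootPoly-at-root a σ))
  ... | υ , τ↭aυ = ↭-trans (↭-prep a (rootPoly-injective σ υ
    (Poly-cancel-linear (rootPoly-Poly σ) (rootPoly-Poly υ) a λ x → ≈-trans (eq x) (rootPoly-↭ τ↭aυ x))))
    (↭-sym τ↭aυ)

  det-2×2 : (M : Matrix 2) → det M ≈ M zero zero * M (suc zero) (suc zero) - M zero (suc zero) * M (suc zero) zero
  det-2×2 M = solve 4 (λ a b c d → :1 :* (a :* (:1 :* (d :* :1) :+ :0)) :+
                                   (:- :1 :* :1 :* (b :* (:1 :* (c :* :1) :+ :0)) :+ :0) := a :* d :- b :* c) ≈-refl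
                (M zero zero) (M zero (suc zero)) (M (suc zero) zero) (M (suc zero) (suc zero))

  -- If s² = n, the symmetric matrix with rows (s, 1) and (1, -s) has the
  -- eigenvalues ± √(n + 1).
  sqrt : ∀ n → ∃[ s ] s * s ≈ n · 1#
  sqrt zero = 0# , zeroˡ 0#
  sqrt (suc n) with sqrt n
  ... | s , s²≈n = root (spectral M M-sym)
    where
    M : Matrix 2
    M zero    zero    = s
    M zero    (suc _) = 1#
    M (suc _) zero    = 1#
    M (suc _) (suc _) = - s

    M-sym : Symmetric M
    M-sym zero       zero       = ≈-refl
    M-sym zero       (suc zero) = ≈-refl
    M-sym (suc zero) zero       = ≈-refl
    M-sym (suc zero) (suc zero) = ≈-refl

    root : ∃ (IsSpectrum M) → ∃[ t ] t * t ≈ suc n · 1#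
    root ([] , () , _)
    root (t ∷ σ , _ , roots) = t , (begin
      t * t
        -- The bracket is the determinant of `χ M t`; it vanishes as `t` is an eigenvalue.
        ≈⟨ solve 2 (λ t s → t :* t := ((t :- s) :* (t :- :- s) :- (:0 :- :1) :* (:0 :- :1)) :+
              (:1 :+ s :* s)) ≈-refl t s ⟩
      ((t - s) * (t - - s) - (0# - 1#) * (0# - 1#)) + (1# + s * s)
        ≈⟨ +-congʳ (det-2×2 (χ M t)) ⟨
      charPoly M t + (1# + s * s)
        ≈⟨ +-cong (≈-trans (roots t) (rootPoly-at-root t σ)) (+-congˡ s²≈n) ⟩
      0# + suc n · 1#
        ≈⟨ +-identityˡ _ ⟩
      suc n · 1# ∎)

-- The spectra of the cone and of the graph with pockets.

module PocketSpectrum {c ℓ : Level} {R : CommutativeRing c ℓ} (D : SpectralDomain R) where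
  open CommutativeRing R hiding (zero)
  open Spectrum R
  open SpectralDomain D
  open Solver R
  open Determinant R using (Det; Det-cong)
  open GraphPolynomial R
  open Roots D
  open Exponentiation semiring using (^-congˡ)
  open SetoidPermutation setoid using (_↭_)
  open SetoidPermutationProperties setoid using (xs↭ys⇒|xs|≡|ys|)
  open SetoidReasoning setoid

  -- `τ` is the spectrum of `delete H v` with one copy of its valency `r` removed. In
  -- `charPoly-cone` the factor `x - ρ` then occurs on both sides and cancels, leaving the quadratic
  -- with roots `α` and `β` times the product over `τ`.
  cone-spectrum : ∀ {N} (H : Graph (2 ℕ+ N)) v r → degree H v ≡ suc N → Regular r (delete H v) →
    ∀ α β → HasRoots (λ x → x * x - (r · 1#) * x - ((2 ℕ+ N) · 1#) + 1#) (α ∷ β ∷ []) →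
    ∀ σ → IsSpectrum (A H) σ →
    ∃[ τ ] length τ ≡ N × σ ↭ α ∷ β ∷ τ ×
      (∀ x → charPoly (A (delete H v)) x ≈ (x - r · 1#) * rootPoly τ x)
  cone-spectrum {N} H v r v-cone regular α β αβ-roots σ (_ , σ-roots)
    with spectral (A (delete H v)) (A-sym (delete H v))
  ... | σ₁ , ∣σ₁∣ , σ₁-roots = result (extract-root ρ σ₁ ρ-root)
    where
    ρ : Carrier
    ρ = r · 1#

    relation : ∀ x → (x - ρ) * rootPoly σ x ≈ ((x - ρ) * x - suc N · 1#) * rootPoly σ₁ x
    relation x = trans (*-congˡ (sym (σ-roots x))) (trans (charPoly-cone H v r v-cone regular x) (*-congˡ
          (σ₁-roots x)))

    -- At `x = ρ` the left side of `relation` is zero and the right side is `- (suc N · 1#)` times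
    -- this value, with a nonzero coefficient in characteristic zero.
    ρ-root : rootPoly σ₁ ρ ≈ 0#
    ρ-root = cancel-factor (suc·1≉0 N) (begin
      suc N · 1# * rootPoly σ₁ ρ
        ≈⟨ solve 3 (λ r n y → n :* y := :- (((r :- r) :* r :- n) :* y))
             refl ρ (suc N · 1#) (rootPoly σ₁ ρ) ⟩
      - (((ρ - ρ) * ρ - suc N · 1#) * rootPoly σ₁ ρ)
        ≈⟨ -‿cong (relation ρ) ⟨
      - ((ρ - ρ) * rootPoly σ ρ)
        ≈⟨ solve 2 (λ r y → :- ((r :- r) :* y) := :0) refl ρ _ ⟩
      0# ∎)

    result : (∃[ τ ] σ₁ ↭ ρ ∷ τ) → ∃[ τ ] length τ ≡ N × σ ↭ α ∷ β ∷ τ ×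
      (∀ x → charPoly (A (delete H v)) x ≈ (x - ρ) * rootPoly τ x)
    result (τ , σ₁↭ρτ) = τ , ℕₚ.suc-injective (≡.trans (≡.sym (xs↭ys⇒|xs|≡|ys| σ₁↭ρτ)) ∣σ₁∣) ,
      rootPoly-injective σ (α ∷ β ∷ τ) (Poly-cancel-linear (rootPoly-Poly σ) (rootPoly-Poly
            (α ∷ β ∷ τ)) ρ σ-relation) ,
      λ x → trans (σ₁-roots x) (rootPoly-↭ σ₁↭ρτ x)
      where
      σ-relation : ∀ x → (x - ρ) * rootPoly σ x ≈ (x - ρ) * rootPoly (α ∷ β ∷ τ) x
      σ-relation x = begin
        (x - ρ) * rootPoly σ x
          ≈⟨ relation x ⟩
        ((x - ρ) * x - suc N · 1#) * rootPoly σ₁ x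
          -- `(2 ℕ+ N) · 1#` unfolds to `1# + suc N · 1#`, which turns the cone factor into the
          -- quadratic of `α` and `β`.
          ≈⟨ *-cong (solve 3 (λ x r n → (x :- r) :* x :- n := x :* x :- r :* x :- (:1 :+ n) :+ :1)
               refl x ρ (suc N · 1#)) (rootPoly-↭ σ₁↭ρτ x) ⟩
        (x * x - ρ * x - (2 ℕ+ N) · 1# + 1#) * ((x - ρ) * rootPoly τ x)
          ≈⟨ *-congʳ (αβ-roots x) ⟩
        ((x - α) * ((x - β) * 1#)) * ((x - ρ) * rootPoly τ x)
          ≈⟨ solve 4 (λ a b r t → (a :* (b :* :1)) :* (r :* t) := r :* (a :* (b :* t)))
               refl (x - α) (x - β) (x - ρ) _ ⟩
        (x - ρ) * ((x - α) * ((x - β) * rootPoly τ x)) ∎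

  -- `rest` is the spectrum of the quotient matrix, which is built from `F`, `p`, `r` and `N` alone
  -- and is therefore fixed before `H` is given.
  pockets-spectrum : ∀ n k N r (F : Graph n) (p : Fin k → Fin n) →
    ∃[ rest ] length rest ≡ n ℕ+ k ×
      (∀ (H : Graph (2 ℕ+ N)) v → degree H v ≡ suc N → Regular r (delete H v) →
       ∀ τ → length τ ≡ N → (∀ x → charPoly (A (delete H v)) x ≈ (x - r · 1#) * rootPoly τ x) →
       IsSpectrum (A (pockets F p H v)) (concatMap (replicate k) τ ++ rest))
  pockets-spectrum n k N r F p with sqrt (suc N)
  ... | s , s²≈N with spectral (quotientMatrix F p (r · 1#) s) (quotientMatrix-sym F p (r · 1#) s)
  ... | rest , ∣rest∣ , rest-roots = rest , ≡.trans ∣rest∣ (≡.cong (n ℕ+_) (ℕₚ.*-identityʳ k)) , with-H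
    where
    ρ : Carrier
    ρ = r · 1#

    with-H : ∀ (H : Graph (2 ℕ+ N)) v → degree H v ≡ suc N → Regular r (delete H v) →
      ∀ τ → length τ ≡ N → (∀ x → charPoly (A (delete H v)) x ≈ (x - ρ) * rootPoly τ x) →
      IsSpectrum (A (pockets F p H v)) (concatMap (replicate k) τ ++ rest)
    -- The spectrum `σ` of the graph with pockets exhibits its characteristic polynomial as a
    -- product of linear factors, hence as a `Poly`, to which cancellation applies.
    with-H H v v-cone regular τ ∣τ∣ τ-roots with spectral (A (pockets F p H v)) (A-sym (pockets F p H v))
    ... | σ , _ , σ-roots = total-length , λ x → trans (σ-roots x)
          (Poly-cancel-power (rootPoly-Poly σ) (rootPoly-Poly (concatMap (replicate k) τ ++ rest)) ρ n relation x)
      where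
      total-length : length (concatMap (replicate k) τ ++ rest) ≡ n ℕ+ k ℕ* suc N
      total-length = ≡.trans (length-++ (concatMap (replicate k) τ)) (≡.trans
        (≡.cong₂ _ℕ+_ (≡.trans (length-repeat k τ) (≡.trans (≡.cong (_ℕ* k) ∣τ∣) (ℕₚ.*-comm N k)))
              (≡.trans ∣rest∣ (≡.cong (n ℕ+_) (ℕₚ.*-identityʳ k))))
        (≡.trans (ℕₚ.+-comm (k ℕ* N) (n ℕ+ k)) (≡.trans (ℕₚ.+-assoc n k (k ℕ* N)) (≡.cong (n ℕ+_) (≡.sym
              (ℕₚ.*-suc k N))))))

      -- `suc N` edges of weight 1 and one edge of weight `s` have the same sum of squared weights,
      -- by the choice of `s`.
      reduced-≈ : ∀ x u w → reduced F p ((suc N · 1#) * (1# * 1#)) (x - ρ) x u w ≈ reduced F p ((1 · 1#) *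
            (s * s)) (x - ρ) x u w
      reduced-≈ x u w = +-congˡ (-‿cong (*-congʳ (trans
        (solve 1 (λ t → t :* (:1 :* :1) := (:1 :+ :0) :* t) refl (suc N · 1#)) (*-congˡ (sym s²≈N)))))

      relation : ∀ x → (x - ρ) ^ n * rootPoly σ x ≈ (x - ρ) ^ n * rootPoly (concatMap (replicate k) τ ++ rest) x
      relation x = begin
        (x - ρ) ^ n * rootPoly σ x
          ≈⟨ trans (*-congˡ (sym (σ-roots x))) (charPoly-pockets F p H v r v-cone regular x) ⟩
        Det (reduced F p ((suc N · 1#) * (1# * 1#)) (x - ρ) x) * charPoly (A (delete H v)) x ^ k
          ≈⟨ *-cong (Det-cong (reduced-≈ x)) (trans (^-congˡ k (τ-roots x)) (*-^ (x - ρ) _ k)) ⟩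
        Det E * ((x - ρ) ^ k * rootPoly τ x ^ k)
          ≈⟨ *-assoc _ _ _ ⟨
        Det E * (x - ρ) ^ k * rootPoly τ x ^ k
          ≈⟨ *-congʳ (charPoly-quotient F p ρ s x) ⟨
        (x - ρ) ^ n * charPoly (quotientMatrix F p ρ s) x * rootPoly τ x ^ k
          ≈⟨ *-cong (*-congˡ (rest-roots x)) (sym (rootPoly-repeat k τ x)) ⟩
        (x - ρ) ^ n * rootPoly rest x * rootPoly (concatMap (replicate k) τ) x
          ≈⟨ solve 3 (λ a b c → a :* b :* c := a :* (c :* b)) refl _ _ _ ⟩
        (x - ρ) ^ n * (rootPoly (concatMap (replicate k) τ) x * rootPoly rest x)
          ≈⟨ *-congˡ (rootPoly-++ (concatMap (replicate k) τ) rest x) ⟨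
        (x - ρ) ^ n * rootPoly (concatMap (replicate k) τ ++ rest) x ∎
        where
        E : Matrix n
        E = reduced F p ((1 · 1#) * (s * s)) (x - ρ) x

-- Independence of the pocket graph is expressed by choosing `rest` before `H` and `v`. Multiplicity
-- `k` is expressed by repeating every entry of `τ` that often. As `p` maps `Fin k` onto a set of
-- `k` vertices, it lists them without repetition.
theorem3p2 : ∀ {c ℓ₁ ℓ₂} (K : SpectralField c ℓ₁ ℓ₂) →
    let open SpectralField K in
    (n k m r₁ : ℕ) → 1 ≤ n → 2 ≤ m → 1 ≤ r₁ →
    (F : Graph n) (Vₖ : Subset n) (p : Fin k → Fin n) →
    (∀ u → u ∈ Vₖ ⇔ (∃[ i ] p i ≡ u)) →
    ∣ Vₖ ∣ ≡ k →
    ∃[ rest ]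
    length rest ≡ n ℕ+ k ×
    (∀ (H : Graph m) (v : Fin m) →
    degree H v ≡ m ∸ 1 →
    Regular r₁ (delete H v) →
    ∀ α β → HasRoots (λ x → x * x - (r₁ · 1#) * x - (m · 1#) + 1#) (α ∷ β ∷ []) →
    ∀ σH → IsSpectrum (A H) σH →
    ∃[ τ ]
    Perm setoid σH (α ∷ β ∷ τ) ×
    IsSpectrum (A (pockets F p H v)) (concatMap (replicate k) τ ++ rest))
-- With `m = 2 + N`, the graph `delete H v` has `suc N` vertices and `τ` has `N` entries.
theorem3p2 K n k (suc (suc N)) r₁ _ (s≤s (s≤s z≤n)) _ F _ p _ _ =
  let rest , ∣rest∣ , pockets-spec = pockets-spectrum n k N r₁ F p in
  rest , ∣rest∣ , λ H v v-cone regular α β αβ-roots σH σH-spectrum →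
    let τ , ∣τ∣ , σH↭ , τ-roots = cone-spectrum H v r₁ v-cone regular α β αβ-roots σH σH-spectrum in
    τ , σH↭ , pockets-spec H v v-cone regular τ ∣τ∣ τ-roots
  where open PocketSpectrum (spectralDomain K)
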